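{- Let $p$ be an odd prime and let $\mathbf{u} = (u_1,u_2,u_3) \in \mathbb{N}^3$ be a solution to $$\frac{4}{p} = \frac{1}{u_1} + \frac{1}{u_2} + \frac{1}{u_3}.$$ Then there exist $i \neq j$ in $\{1,2,3\}$ such that $u_i/u_j \in \mathbb{Z}_p^*$. Moreover, for any such $i \neq j$ we have $$\left(\frac{ -u_i/u_j}{p}\right) = -1.$$
   Context: $\mathbb{N}$ denotes the positive integers. $\left(\frac{\cdot}{p}\right)$ is the Legendre symbol, applied to an element of $\mathbb{Z}_p^*$ via its reduction modulo $p$. -}

module Defs where

open import Data.Nat as ℕ using (ℕ; suc)
open import Data.Integer using (ℤ; +_; -_; _+_; _-_; _*_; 0ℤ; 1ℤ; -1ℤ)
open import Data.Integer.Divisibility.Signed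
  using (_∣_; _∣?_; ∣m∣n⇒∣m+n; ∣m⇒∣-m; ∣n⇒∣m*n; divides)
open import Data.Integer.Tactic.RingSolver using (solve-∀)
open import Data.Fin using (Fin; toℕ)
open import Data.Fin.Properties using (any?)
open import Data.Product using (∃; Σ-syntax; _×_)
open import Data.Rational using (ℚ; ↥_; ↧_)
open import Relation.Nullary using (Dec; yes; no)
open import Relation.Binary.PropositionalEquality using (_≡_; subst)

infix 4 _≡_[mod_]

_≡_[mod_] : ℤ → ℤ → ℕ → Set
a ≡ b [mod m ] = + m ∣ a - b

-- The p-adic integers as the inverse limit of the rings ℤ/pⁿ. Each residue
-- class is given by an arbitrary integer representative, so equality of
-- p-adic integers is the setoid relation _≈_ below.
record ℤₚ (p : ℕ) : Set where
  field
    approx     : ℕ → ℤ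
    compatible : ∀ n → approx (suc n) ≡ approx n [mod p ℕ.^ n ]

open ℤₚ public

module _ {p : ℕ} where

  infix  4 _≈_
  infixl 7 _·_
  infix  8 ⊖_

  _≈_ : ℤₚ p → ℤₚ p → Set
  x ≈ y = ∀ n → approx x n ≡ approx y n [mod p ℕ.^ n ]

  fromℤ : ℤ → ℤₚ p
  fromℤ a .approx _ = a
  fromℤ a .compatible n = divides 0ℤ (a-a≡0*m a (+ (p ℕ.^ n)))
    where
    a-a≡0*m : ∀ a m → a - a ≡ 0ℤ * m
    a-a≡0*m = solve-∀

  _·_ : ℤₚ p → ℤₚ p → ℤₚ p
  (x · y) .approx n = approx x n * approx y n
  (x · y) .compatible n =
    subst (_ ∣_) (identity (approx x (suc n)) (approx x n) (approx y (suc n)) (approx y n))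
      (∣m∣n⇒∣m+n (∣n⇒∣m*n (approx x (suc n)) (compatible y n))
                 (∣n⇒∣m*n (approx y n) (compatible x n)))
    where
    identity : ∀ a b c d → a * (c - d) + d * (a - b) ≡ a * c - b * d
    identity = solve-∀

  ⊖_ : ℤₚ p → ℤₚ p
  (⊖ x) .approx n = - approx x n
  (⊖ x) .compatible n =
    subst (_ ∣_) (identity (approx x (suc n)) (approx x n)) (∣m⇒∣-m (compatible x n))
    where
    identity : ∀ a b → - (a - b) ≡ - a - - b
    identity = solve-∀

  IsUnit : ℤₚ p → Set
  IsUnit x = ∃ λ y → x · y ≈ fromℤ 1ℤ

  -- Equality of x and q in ℚₚ, the fraction field of ℤₚ: x / 1 = ↥ q / ↧ q,
  -- cross-multiplied.
  _≈ℚ_ : ℤₚ p → ℚ → Set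
  x ≈ℚ q = x · fromℤ (↧ q) ≈ fromℤ (↥ q)

  infix 4 _≈ℚ_

  -- A representative in ℤ of the image of x in ℤₚ / p ℤₚ = ℤ/p.
  reduction : ℤₚ p → ℤ
  reduction x = approx x 1

-- q ∈ ℤₚˣ, regarding both ℚ and ℤₚˣ as subsets of ℚₚ.
_∈ℤˣ[_] : ℚ → ℕ → Set
q ∈ℤˣ[ p ] = Σ[ x ∈ ℤₚ p ] (IsUnit x × x ≈ℚ q)

infix 4 _∈ℤˣ[_]

IsSquareMod : ℕ → ℤ → Set
IsSquareMod p a = ∃ λ (b : Fin p) → + toℕ b * + toℕ b ≡ a [mod p ]

isSquareMod? : ∀ p a → Dec (IsSquareMod p a)
isSquareMod? p a = any? λ b → + p ∣? (+ toℕ b * + toℕ b - a)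

legendre : ℕ → ℤ → ℤ
legendre p a with + p ∣? a | isSquareMod? p a
... | yes _ | _     = 0ℤ
... | no  _ | yes _ = 1ℤ
... | no  _ | no  _ = -1ℤ

legendreℤₚ : ∀ {p} → ℤₚ p → ℤ
legendreℤₚ {p} x = legendre p (reduction x)

{-# OPTIONS --safe #-}
-- Let x be the smallest of the three denominators. Comparing sizes gives x < p and
-- d = 4x − p > 0, and the other two, y = g b and z = g c with b, c coprime, satisfy
-- d g b c = p x (b + c). If p divides neither b nor c, then x = b c t and d s = b + c,
-- so −b c ≡ b² modulo d. If p divides b = p b′, then x = b′ c t and d s = p b′ + c, so
-- −t ≡ (2 b′ t)² modulo d. In both cases p + d = 4 N k with −N (N = b c or N = t) a
-- square modulo d, and −N agrees with the negated ratio up to squares modulo p, so that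
-- it remains to see that −N is not a square modulo both p and d.
--
-- This is quadratic reciprocity for moduli that need not be prime. Let G(m) be the sum
-- of ⌊2Nj/m⌋ over 0 ≤ j ≤ h, where m = 2h + 1. As in Gauss's lemma, G(m) ≡ h modulo 2
-- if −N is a square modulo m, while Eisenstein's lattice point count shows that G(p)
-- and G(d) have the same parity when p + d is a multiple of 4N. Since (p + d)/2 is
-- even, the two values of h have different parities.

module Submission where

open import Defs

-- Quadratic reciprocity for odd moduli that need not be prime.

module Reciprocity where

  open import Data.Empty using (⊥)
  open import Data.Fin using (Fin; zero; suc; toℕ; fromℕ<; punchOut)
  open import Data.Fin.Properties
    using (toℕ-injective; toℕ≤pred[n]; toℕ-fromℕ<; punchOut-injective; injective⇒≤; any?)
  import Data.Fin.Properties as Fin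
  open import Data.Fin.Permutation using (Permutation′; permutation)
  open import Data.Integer as ℤ using (ℤ; +_; -_; 0ℤ)
  import Data.Integer.Properties as ℤ
  open import Data.Integer.Divisibility.Signed as ℤ∣
    using (∣ᵤ⇒∣; ∣⇒∣ᵤ; ∣m∣n⇒∣m+n; ∣n⇒∣m*n; ∣m⇒∣-m)
  import Data.Integer.Tactic.RingSolver as ℤSolver
  open import Data.Nat
    using (ℕ; zero; suc; _≤_; _<_; z≤n; s≤s; s≤s⁻¹; NonZero; _≤?_; _+_; _*_; _∸_; _/_; _%_; parity)
  open import Data.Nat.Coprimality using (Coprime; coprime-divisor)
  import Data.Nat.Coprimality as Coprimality
  open import Data.Nat.Divisibility using (m%n≡0⇒n∣m; _∣_; divides; ∣m+n∣m⇒∣n; ∣m⇒∣m*n)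
  import Data.Nat.Divisibility as ℕ∣
  open import Data.Nat.DivMod
    using ( m≡m%n+[m/n]*n; m%n<n; +-distrib-/-∣ʳ; m<n⇒m/n≡0; m*n/n≡m; m<n*o⇒m/o<n
          ; /-monoˡ-≤; m/n*n≤m)
  open import Data.Nat.Properties
  import Data.Nat.Tactic.RingSolver as ℕSolver
  open import Data.Parity as ℙ using (Parity; 0ℙ; 1ℙ)
  import Data.Parity.Properties as ℙ
  open import Data.Product using (∃; _,_; proj₁; proj₂)
  open import Function using (_∘_; _$_; Injective)
  open import Relation.Binary.PropositionalEquality
    using (_≡_; _≢_; refl; sym; trans; cong; cong₂; subst; subst₂; module ≡-Reasoning)
  open import Relation.Nullary using (¬_; yes; no; contradiction)

  open import Algebra.Properties.CommutativeMonoid.Sum ℙ.+-0-commutativeMonoid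
    using (sum; sum-permute; ∑-distrib-+; ∑-comm; sum-cong-≗; sum-replicate-zero; sum-syntax)

  private
    variable
      n : ℕ

  -- A missed value `y` could be punched out of the codomain, leaving an injection of `Fin (suc n)`
  -- into `Fin n`.
  injective⇒surjective : {f : Fin n → Fin n} → Injective _≡_ _≡_ f → ∀ y → ∃ λ x → f x ≡ y
  injective⇒surjective {suc n} {f} inj y with any? (λ x → f x Fin.≟ y)
  ... | yes p = p
  ... | no ∄x = contradiction (injective⇒≤ {f = g} g-injective) (<⇒≱ ≤-refl)
    where
    y≢f : ∀ x → y ≢ f x
    y≢f x eq = ∄x (x , sym eq)
    g : Fin (suc n) → Fin n
    g x = punchOut (y≢f x)
    g-injective : Injective _≡_ _≡_ g
    g-injective eq = inj (punchOut-injective (y≢f _) (y≢f _) eq)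

  injective⇒permutation : {f : Fin n → Fin n} → Injective _≡_ _≡_ f → Permutation′ n
  injective⇒permutation {f = f} inj = permutation f g f∘g≡id (λ x → inj (f∘g≡id (f x)))
    where
    g = λ y → proj₁ (injective⇒surjective inj y)
    f∘g≡id = λ y → proj₂ (injective⇒surjective inj y)

  parity[2*n]≡0ℙ : ∀ n → parity (2 * n) ≡ 0ℙ
  parity[2*n]≡0ℙ n = ℙ.*-homo-* 2 n

  sum-1ℙ : ∀ n → ∑[ i < n ] 1ℙ ≡ parity n
  sum-1ℙ zero = refl
  sum-1ℙ (suc n) = trans (cong (1ℙ ℙ.+_) (sum-1ℙ n)) (sym (ℙ.+-homo-+ 1 n))

  -- Signs acting on the integers.

  infixr 8 _▹_
  -- Signs are written additively, so that they live in the same group as the parities of floors and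
  -- can be summed.
  _▹_ : Parity → ℤ → ℤ
  0ℙ ▹ a = a
  1ℙ ▹ a = - a

  ▹-∘ : ∀ s s′ a → s ▹ s′ ▹ a ≡ (s ℙ.+ s′) ▹ a
  ▹-∘ 0ℙ s′ a = refl
  ▹-∘ 1ℙ 0ℙ a = refl
  ▹-∘ 1ℙ 1ℙ a = ℤ.neg-involutive a

  ▹-involutive : ∀ s a → s ▹ s ▹ a ≡ a
  ▹-involutive 0ℙ a = refl
  ▹-involutive 1ℙ a = ℤ.neg-involutive a

  ▹-* : ∀ s a b → a ℤ.* s ▹ b ≡ s ▹ (a ℤ.* b)
  ▹-* 0ℙ a b = refl
  ▹-* 1ℙ a b = sym (ℤ.neg-distribʳ-* a b)

  ▹-- : ∀ s a b → s ▹ a ℤ.- s ▹ b ≡ s ▹ (a ℤ.- b)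
  ▹-- 0ℙ a b = refl
  ▹-- 1ℙ a b = sym (ℤ.neg-distrib-+ a (- b))

  ∣▹∣ : ∀ s a → ℤ.∣ s ▹ a ∣ ≡ ℤ.∣ a ∣
  ∣▹∣ 0ℙ a = refl
  ∣▹∣ 1ℙ a = ℤ.∣-i∣≡∣i∣ a

  ∣⇒∣▹ : ∀ {k a} s → k ℤ∣.∣ a → k ℤ∣.∣ s ▹ a
  ∣⇒∣▹ 0ℙ k∣a = k∣a
  ∣⇒∣▹ 1ℙ k∣a = ∣m⇒∣-m k∣a

  /-unique : ∀ {a} q {r d} .{{_ : NonZero d}} → a ≡ r + q * d → r < d → a / d ≡ q
  /-unique q {r} {d} refl r<d = begin
    (r + q * d) / d       ≡⟨ +-distrib-/-∣ʳ r (divides q refl) ⟩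
    r / d + q * d / d     ≡⟨ cong₂ _+_ (m<n⇒m/n≡0 r<d) (m*n/n≡m q d) ⟩
    q                     ∎
    where open ≡-Reasoning

  -- The half system modulo an odd number and Gauss's lemma.

  module HalfSystem (h : ℕ) where

    m = 1 + 2 * h

    -- A record, unlike _≡_[mod_], so that a and b can be inferred from a ≋ b.
    infix 4 _≋_
    record _≋_ (a b : ℤ) : Set where
      constructor cong-mod
      field m∣a-b : + m ℤ∣.∣ a ℤ.- b

    ≋-trans : ∀ {a b c} → a ≋ b → b ≋ c → a ≋ c
    ≋-trans {a} {b} {c} (cong-mod p) (cong-mod q) = cong-mod $ subst (_ ℤ∣.∣_) (identity a b c) (∣m∣n⇒∣m+n p q)
      where
      identity : ∀ a b c → (a ℤ.- b) ℤ.+ (b ℤ.- c) ≡ a ℤ.- c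
      identity = ℤSolver.solve-∀

    ≋-sym : ∀ {a b} → a ≋ b → b ≋ a
    ≋-sym {a} {b} (cong-mod p) = cong-mod $ subst (_ ℤ∣.∣_) (identity a b) (∣m⇒∣-m p)
      where
      identity : ∀ a b → - (a ℤ.- b) ≡ b ℤ.- a
      identity = ℤSolver.solve-∀

    ≋-▹ : ∀ {a b} s → a ≋ b → s ▹ a ≋ s ▹ b
    ≋-▹ {a} {b} s (cong-mod p) = cong-mod $ subst (_ ℤ∣.∣_) (sym (▹-- s a b)) (∣⇒∣▹ s p)

    ≋-▹⁻¹ : ∀ {a b} s → a ≋ s ▹ b → s ▹ a ≋ b
    ≋-▹⁻¹ {a} {b} s p = subst (s ▹ a ≋_) (▹-involutive s b) (≋-▹ s p)

    ≋-* : ∀ {a b} c → a ≋ b → c ℤ.* a ≋ c ℤ.* b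
    ≋-* {a} {b} c (cong-mod p) = cong-mod $ subst (_ ℤ∣.∣_) (identity a b c) (∣n⇒∣m*n c p)
      where
      identity : ∀ a b c → c ℤ.* (a ℤ.- b) ≡ c ℤ.* a ℤ.- c ℤ.* b
      identity = ℤSolver.solve-∀

    ≋-reflexive : ∀ {a b} → a ≡ b → a ≋ b
    ≋-reflexive {a} refl = cong-mod (ℤ∣.divides 0ℤ (ℤ.+-inverseʳ a))

    m∣n∧n<m⇒n≡0 : ∀ {n} → m ∣ n → n < m → n ≡ 0
    m∣n∧n<m⇒n≡0 {zero}  _   _   = refl
    m∣n∧n<m⇒n≡0 {suc n} m∣n n<m = contradiction (ℕ∣.∣⇒≤ m∣n) (<⇒≱ n<m)

    -- The difference has absolute value at most `j + k ≤ 2 h < m`, so as a multiple of `m` it can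
    -- only be zero.
    ≋⇒≡ : ∀ {j k} s → j ≤ h → k ≤ h → + j ≋ s ▹ + k → + j ≡ s ▹ + k
    ≋⇒≡ {j} {k} s j≤h k≤h (cong-mod p) = ℤ.i-j≡0⇒i≡j _ _ (ℤ.∣i∣≡0⇒i≡0 (m∣n∧n<m⇒n≡0 (∣⇒∣ᵤ p) bound))
      where
      open ≤-Reasoning
      bound : ℤ.∣ + j ℤ.- s ▹ + k ∣ < m
      bound = begin-strict
        ℤ.∣ + j ℤ.- s ▹ + k ∣   ≤⟨ ℤ.∣i-j∣≤∣i∣+∣j∣ (+ j) (s ▹ + k) ⟩
        j + ℤ.∣ s ▹ + k ∣       ≡⟨ cong (_+_ j) (∣▹∣ s (+ k)) ⟩
        j + k                   ≤⟨ +-mono-≤ j≤h (≤-trans k≤h (m≤m+n h 0)) ⟩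
        2 * h                   <⟨ n<1+n _ ⟩
        m                       ∎

    ≋⇒≡-abs : ∀ {j k} s → j ≤ h → k ≤ h → + j ≋ s ▹ + k → j ≡ k
    ≋⇒≡-abs {j} {k} s j≤h k≤h p = trans (cong ℤ.∣_∣ (≋⇒≡ s j≤h k≤h p)) (∣▹∣ s (+ k))

    -- A positive `j` cannot equal `−k` as an integer; at zero the sign would be ambiguous.
    ≋⇒≡-sign : ∀ {j k} s → j ≢ 0 → j ≤ h → k ≤ h → + j ≋ s ▹ + k → s ≡ 0ℙ
    ≋⇒≡-sign {zero}  {_}     s  0≢0 _   _   _ = contradiction refl 0≢0
    ≋⇒≡-sign {suc j} {_}     0ℙ _   _   _   _ = refl
    ≋⇒≡-sign {suc j} {zero}  1ℙ _   j≤h k≤h p with () ← ≋⇒≡ 1ℙ j≤h k≤h p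
    ≋⇒≡-sign {suc j} {suc k} 1ℙ _   j≤h k≤h p with () ← ≋⇒≡ 1ℙ j≤h k≤h p

    -- Gauss's sign: `2 * a / m` is even if the residue of `a` modulo `m` is at most `h`, and odd if
    -- it exceeds `h`.
    floorSign : ℕ → Parity
    floorSign a = parity (2 * a / m)


    fold : ∀ a → ∃ λ (t : Fin (suc h)) → + a ≋ floorSign a ▹ + toℕ t
    fold a with a % m | a / m | m≡m%n+[m/n]*n a m | m%n<n a m
    ... | r | q | eq | r<m with r ≤? h
    ... | yes r≤h = fromℕ< (s≤s r≤h) , subst₂ (λ s t → + a ≋ s ▹ + t) (sym sign) (sym (toℕ-fromℕ< _)) cong-r
      where
      double : 2 * a ≡ 2 * r + 2 * q * m
      double = trans (cong (_*_ 2) eq) (identity r q m)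
        where
        identity : ∀ r q m → 2 * (r + q * m) ≡ 2 * r + 2 * q * m
        identity = ℕSolver.solve-∀
      sign : floorSign a ≡ 0ℙ
      sign = trans (cong parity (/-unique (2 * q) double (s≤s (*-monoʳ-≤ 2 r≤h)))) (parity[2*n]≡0ℙ q)
      cong-r : + a ≋ + r
      cong-r = cong-mod $ ℤ∣.divides (+ q) (begin
        + a ℤ.- + r                   ≡⟨ cong (λ x → + x ℤ.- + r) eq ⟩
        + (r + q * m) ℤ.- + r         ≡⟨ cong (λ x → + r ℤ.+ x ℤ.- + r) (ℤ.pos-* q m) ⟩
        + r ℤ.+ + q ℤ.* + m ℤ.- + r   ≡⟨ identity (+ r) (+ q) (+ m) ⟩
        + q ℤ.* + m                   ∎)
        where
        open ≡-Reasoning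
        identity : ∀ r q m → r ℤ.+ q ℤ.* m ℤ.- r ≡ q ℤ.* m
        identity = ℤSolver.solve-∀
    -- With `r = suc h + e`, the residue of least absolute value is `r − m = −(h − e)`.
    ... | no r≰h with e , refl ← m≤n⇒∃[o]m+o≡n (≰⇒> r≰h) =
      fromℕ< (s≤s (m∸n≤m h e)) , subst₂ (λ s t → + a ≋ s ▹ + t) (sym sign) (sym (toℕ-fromℕ< _)) cong-r
      where
      e<h : e < h
      e<h = +-cancelˡ-< (suc h) e h (subst (suc h + e <_) (cong suc (cong (_+_ h) (+-identityʳ h))) r<m)
      double : 2 * a ≡ (1 + 2 * e) + (1 + 2 * q) * m
      double = trans (cong (_*_ 2) eq) (identity h e q)
        where
        identity : ∀ h e q → 2 * (suc h + e + q * (1 + 2 * h)) ≡ (1 + 2 * e) + (1 + 2 * q) * (1 + 2 * h)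
        identity = ℕSolver.solve-∀
      sign : floorSign a ≡ 1ℙ
      sign = trans (cong parity (/-unique (1 + 2 * q) double (s≤s (*-monoʳ-< 2 e<h))))
                   (trans (ℙ.+-homo-+ 1 (2 * q)) (cong (1ℙ ℙ.+_) (parity[2*n]≡0ℙ q)))
      cong-r : + a ≋ - (+ (h ∸ e))
      cong-r = cong-mod $ ℤ∣.divides (+ (1 + q)) (begin
        + a ℤ.- - (+ (h ∸ e))      ≡⟨ cong (ℤ._+_ (+ a)) (ℤ.neg-involutive (+ (h ∸ e))) ⟩
        + (a + (h ∸ e))            ≡⟨ cong +_ sum≡ ⟩
        + ((1 + q) * m)            ≡⟨ ℤ.pos-* (1 + q) m ⟩
        + (1 + q) ℤ.* + m          ∎)
        where
        open ≡-Reasoning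
        identity : ∀ h q e d → suc h + e + q * (1 + 2 * h) + d ≡ (e + d) + (suc h + q * (1 + 2 * h))
        identity = ℕSolver.solve-∀
        identity′ : ∀ h q → h + (suc h + q * (1 + 2 * h)) ≡ (1 + q) * (1 + 2 * h)
        identity′ = ℕSolver.solve-∀
        sum≡ : a + (h ∸ e) ≡ (1 + q) * m
        sum≡ = begin
          a + (h ∸ e)                             ≡⟨ cong (_+ (h ∸ e)) eq ⟩
          suc h + e + q * m + (h ∸ e)             ≡⟨ identity h q e (h ∸ e) ⟩
          (e + (h ∸ e)) + (suc h + q * m)         ≡⟨ cong (_+ (suc h + q * m)) (m+[n∸m]≡n (<⇒≤ e<h)) ⟩
          h + (suc h + q * m)                     ≡⟨ identity′ h q ⟩
          (1 + q) * m                             ∎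

    ≋-cancel : ∀ {a x y} → Coprime m a → + a ℤ.* x ≋ + a ℤ.* y → x ≋ y
    ≋-cancel {a} {x} {y} cop (cong-mod p) = cong-mod $ ∣ᵤ⇒∣ (coprime-divisor cop
      (subst (m ∣_) (ℤ.abs-* (+ a) (x ℤ.- y)) (∣⇒∣ᵤ (subst (_ ℤ∣.∣_) (identity (+ a) x y) p))))
      where
      identity : ∀ a x y → a ℤ.* x ℤ.- a ℤ.* y ≡ a ℤ.* (x ℤ.- y)
      identity = ℤSolver.solve-∀

    m∤suc-toℕ : ∀ (j : Fin h) → ¬ m ∣ suc (toℕ j)
    m∤suc-toℕ j m∣j = contradiction (m∣n∧n<m⇒n≡0 m∣j (s≤s (≤-trans (Fin.toℕ<n j) (m≤m+n h _)))) λ ()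

    floorSign-0 : ∀ a → floorSign (a * 0) ≡ 0ℙ
    floorSign-0 a rewrite *-zeroʳ a = refl

    module _ {N w : ℕ} (m∣w²+N : m ∣ w * w + N) (N⊥m : Coprime N m) where

      private
        m⊥w : Coprime m w
        m⊥w (d∣m , d∣w) = N⊥m (∣m+n∣m⇒∣n (ℕ∣.∣-trans d∣m m∣w²+N) (∣m⇒∣m*n w d∣w) , d∣m)

        f g : Fin (suc h) → Parity
        f j = floorSign (w * toℕ j)
        g j = floorSign (N * toℕ j)

        -- Absolute values of the least residues of `w j` and `N j`, whose signs are `f j` and
        -- `g j`.
        σ τ : Fin (suc h) → Fin (suc h)
        σ j = proj₁ (fold (w * toℕ j))
        τ j = proj₁ (fold (N * toℕ j))

        σ-≋ : ∀ j → + w ℤ.* + toℕ j ≋ f j ▹ + toℕ (σ j)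
        σ-≋ j = subst (_≋ f j ▹ + toℕ (σ j)) (ℤ.pos-* w (toℕ j)) (proj₂ (fold (w * toℕ j)))

        τ-≋ : ∀ j → + N ℤ.* + toℕ j ≋ g j ▹ + toℕ (τ j)
        τ-≋ j = subst (_≋ g j ▹ + toℕ (τ j)) (ℤ.pos-* N (toℕ j)) (proj₂ (fold (N * toℕ j)))

        -- `w` is invertible modulo `m`, so `w j ≡ ± w k` gives `j ≡ ± k`, and within the half
        -- system this means `j = k`.
        σ-injective : Injective _≡_ _≡_ σ
        σ-injective {j} {k} eq = toℕ-injective (≋⇒≡-abs (f j ℙ.+ f k) (toℕ≤pred[n] j) (toℕ≤pred[n] k)
          (≋-cancel m⊥w (≋-trans (σ-≋ j) (≋-trans (≋-▹ (f j) σj≋) (≋-reflexive rearranged)))))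
          where
          σj≋ : + toℕ (σ j) ≋ f k ▹ (+ w ℤ.* + toℕ k)
          σj≋ = subst (λ x → + toℕ x ≋ f k ▹ (+ w ℤ.* + toℕ k)) (sym eq) (≋-sym (≋-▹⁻¹ (f k) (σ-≋ k)))
          rearranged : f j ▹ f k ▹ (+ w ℤ.* + toℕ k) ≡ + w ℤ.* (f j ℙ.+ f k) ▹ + toℕ k
          rearranged = trans (▹-∘ (f j) (f k) _) (sym (▹-* (f j ℙ.+ f k) (+ w) (+ toℕ k)))

        N≋-w² : ∀ x → + N ℤ.* x ≋ 1ℙ ▹ (+ w ℤ.* (+ w ℤ.* x))
        N≋-w² x = cong-mod $ subst (_ ℤ∣.∣_) eq (∣n⇒∣m*n x (∣ᵤ⇒∣ {+ m} {+ (w * w + N)} m∣w²+N))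
          where
          identity : ∀ w N x → x ℤ.* (w ℤ.* w ℤ.+ N) ≡ N ℤ.* x ℤ.- - (w ℤ.* (w ℤ.* x))
          identity = ℤSolver.solve-∀
          eq : x ℤ.* + (w * w + N) ≡ + N ℤ.* x ℤ.- - (+ w ℤ.* (+ w ℤ.* x))
          eq = trans (cong (λ y → x ℤ.* (y ℤ.+ + N)) (ℤ.pos-* w w)) (identity (+ w) (+ N) x)

        N≋σ² : ∀ j → + N ℤ.* + toℕ j ≋ (1ℙ ℙ.+ (f j ℙ.+ f (σ j))) ▹ + toℕ (σ (σ j))
        N≋σ² j = ≋-trans (N≋-w² _) (subst (λ x → 1ℙ ▹ (+ w ℤ.* (+ w ℤ.* + toℕ j)) ≋ x) (▹-∘ 1ℙ (f j ℙ.+ f (σ j)) _)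
          (≋-▹ 1ℙ (≋-trans (≋-* (+ w) (σ-≋ j)) (≋-trans (≋-reflexive (▹-* (f j) (+ w) (+ toℕ (σ j))))
            (subst (f j ▹ (+ w ℤ.* + toℕ (σ j)) ≋_) (▹-∘ (f j) (f (σ j)) _) (≋-▹ (f j) (σ-≋ (σ j))))))))

        -- The minus sign in `N ≡ −w²`, dropped at zero, where `floorSign` takes the value `0ℙ`.
        χ : Fin (suc h) → Parity
        χ zero    = 0ℙ
        χ (suc _) = 1ℙ

        -- `N` is invertible modulo `m`, so `N j` vanishes for no `j` from 1 to `h`; this makes the
        -- sign of `N j` unambiguous.
        τ-suc≢0 : ∀ (j : Fin h) → toℕ (τ (suc j)) ≢ 0
        τ-suc≢0 j eq = m∤suc-toℕ j (coprime-divisor {n = N} (Coprimality.sym N⊥m)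
          (subst (m ∣_) (ℤ.abs-* (+ N) (+ toℕ (suc j))) (∣⇒∣ᵤ (subst (_ ℤ∣.∣_) (ℤ.+-identityʳ (+ N ℤ.* + toℕ (suc j))) (_≋_.m∣a-b N≋0)))))
          where
          ▹0 : ∀ s → s ▹ 0ℤ ≡ 0ℤ
          ▹0 0ℙ = refl
          ▹0 1ℙ = refl
          N≋0 : + N ℤ.* + toℕ (suc j) ≋ 0ℤ
          N≋0 = subst (+ N ℤ.* + toℕ (suc j) ≋_)
            (trans (cong (λ x → g (suc j) ▹ + x) eq) (▹0 (g (suc j)))) (τ-≋ (suc j))

        -- N j ≡ −w (w j), so the sign of N j is that of w j times that of w (σ j),
        -- negated; only j = 0 is an exception, its sign being ambiguous.
        g≡ : ∀ j → g j ≡ χ j ℙ.+ (f j ℙ.+ f (σ j))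
        g≡ zero = begin
          g zero                   ≡⟨ floorSign-0 N ⟩
          0ℙ                       ≡⟨ ℙ.p+p≡0ℙ (f zero) ⟨
          f zero ℙ.+ f zero        ≡⟨ cong (λ x → f zero ℙ.+ f x) σ0≡0 ⟨
          f zero ℙ.+ f (σ zero)    ∎
          where
          open ≡-Reasoning
          σ0≡0 : σ zero ≡ zero
          σ0≡0 = toℕ-injective (sym (≋⇒≡-abs (f zero) z≤n (toℕ≤pred[n] (σ zero))
            (subst (_≋ f zero ▹ + toℕ (σ zero)) (ℤ.*-zeroʳ (+ w)) (σ-≋ zero))))
        g≡ (suc j) = begin
          g′                  ≡⟨ ℙ.+-identityʳ g′ ⟨
          g′ ℙ.+ 0ℙ           ≡⟨ cong (g′ ℙ.+_) s≡0 ⟨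
          g′ ℙ.+ (g′ ℙ.+ c)   ≡⟨ ℙ.+-assoc g′ g′ c ⟨
          (g′ ℙ.+ g′) ℙ.+ c   ≡⟨ cong (ℙ._+ c) (ℙ.p+p≡0ℙ g′) ⟩
          c                   ∎
          where
          open ≡-Reasoning
          g′ = g (suc j)
          c = 1ℙ ℙ.+ (f (suc j) ℙ.+ f (σ (suc j)))
          s≡0 : g′ ℙ.+ c ≡ 0ℙ
          s≡0 = ≋⇒≡-sign (g′ ℙ.+ c) (τ-suc≢0 j) (toℕ≤pred[n] (τ (suc j))) (toℕ≤pred[n] (σ (σ (suc j))))
            (≋-trans (≋-sym (≋-▹⁻¹ g′ (τ-≋ (suc j))))
              (subst (g′ ▹ (+ N ℤ.* + toℕ (suc j)) ≋_) (▹-∘ g′ c _) (≋-▹ g′ (N≋σ² (suc j)))))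

      -- The analogue of Gauss's lemma: `σ` permutes the half system, so `f` and `f ∘ σ` have the
      -- same sum and cancel modulo 2, leaving one minus sign for each of the `h` nonzero `j`.
      ∑floorSign-N : ∑[ j < suc h ] floorSign (N * toℕ j) ≡ parity h
      ∑floorSign-N = begin
        sum g                                   ≡⟨ sum-cong-≗ g≡ ⟩
        ∑[ j < suc h ] (χ j ℙ.+ (f j ℙ.+ f (σ j)))  ≡⟨ ∑-distrib-+ χ (λ j → f j ℙ.+ f (σ j)) ⟩
        sum χ ℙ.+ ∑[ j < suc h ] (f j ℙ.+ f (σ j))  ≡⟨ cong (sum χ ℙ.+_) (∑-distrib-+ f (λ j → f (σ j))) ⟩
        sum χ ℙ.+ (sum f ℙ.+ sum (f ∘ σ))       ≡⟨ cong (λ x → sum χ ℙ.+ (sum f ℙ.+ x)) (sum-permute f (injective⇒permutation σ-injective)) ⟨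
        sum χ ℙ.+ (sum f ℙ.+ sum f)             ≡⟨ cong (sum χ ℙ.+_) (ℙ.p+p≡0ℙ (sum f)) ⟩
        sum χ ℙ.+ 0ℙ                            ≡⟨ ℙ.+-identityʳ (sum χ) ⟩
        sum χ                                   ≡⟨ sum-1ℙ h ⟩
        parity h                                ∎
        where open ≡-Reasoning

  -- Counting lattice points modulo 2.

  ⟦_≤_⟧ : ℕ → ℕ → Parity
  ⟦ zero  ≤ b     ⟧ = 1ℙ
  ⟦ suc a ≤ zero  ⟧ = 0ℙ
  ⟦ suc a ≤ suc b ⟧ = ⟦ a ≤ b ⟧

  ⟦≤⟧-cong : ∀ {a b c d} → (a ≤ b → c ≤ d) → (c ≤ d → a ≤ b) → ⟦ a ≤ b ⟧ ≡ ⟦ c ≤ d ⟧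
  ⟦≤⟧-cong {a} {b} {c} {d} f g with a ≤? b
  ... | yes a≤b = trans (true a≤b) (sym (true (f a≤b)))
    where
    true : ∀ {a b} → a ≤ b → ⟦ a ≤ b ⟧ ≡ 1ℙ
    true z≤n       = refl
    true (s≤s a≤b) = true a≤b
  ... | no  a≰b = trans (false a≰b) (sym (false (a≰b ∘ g)))
    where
    false : ∀ {a b} → ¬ a ≤ b → ⟦ a ≤ b ⟧ ≡ 0ℙ
    false {zero}          a≰b = contradiction z≤n a≰b
    false {suc a} {zero}  a≰b = refl
    false {suc a} {suc b} a≰b = false (a≰b ∘ s≤s)

  ⟦≤⟧-flip : ∀ {a b} → a ≢ b → ⟦ a ≤ b ⟧ ≡ 1ℙ ℙ.+ ⟦ b ≤ a ⟧
  ⟦≤⟧-flip {zero}  {zero}  a≢b = contradiction refl a≢b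
  ⟦≤⟧-flip {zero}  {suc b} a≢b = refl
  ⟦≤⟧-flip {suc a} {zero}  a≢b = refl
  ⟦≤⟧-flip {suc a} {suc b} a≢b = ⟦≤⟧-flip (a≢b ∘ cong suc)

  ∑⟦≤⟧ : ∀ n {q} → q ≤ n → ∑[ i < n ] ⟦ suc (toℕ i) ≤ q ⟧ ≡ parity q
  ∑⟦≤⟧ n       z≤n       = sum-replicate-zero n
  ∑⟦≤⟧ (suc n) (s≤s {q} q≤n) = trans (cong (1ℙ ℙ.+_) (∑⟦≤⟧ n q≤n)) (sym (ℙ.+-homo-+ 1 q))

  -- There are `x / d` positive multiples of `d` up to `x`, and the bound on `x` puts all of them
  -- among the first `n`.
  ∑-multiples≤ : ∀ n x d .{{_ : NonZero d}} → x < suc n * d →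
                 ∑[ i < n ] ⟦ suc (toℕ i) * d ≤ x ⟧ ≡ parity (x / d)
  ∑-multiples≤ n x d x< = trans
    (sum-cong-≗ {n} (λ i → ⟦≤⟧-cong (*≤⇒≤/ (suc (toℕ i))) (≤/⇒*≤ (suc (toℕ i)))))
    (∑⟦≤⟧ n (s≤s⁻¹ (m<n*o⇒m/o<n x<)))
    where
    *≤⇒≤/ : ∀ a → a * d ≤ x → a ≤ x / d
    *≤⇒≤/ a ad≤x = subst (_≤ x / d) (m*n/n≡m a d) (/-monoˡ-≤ d ad≤x)
    ≤/⇒*≤ : ∀ a → a ≤ x / d → a * d ≤ x
    ≤/⇒*≤ a a≤ = ≤-trans (*-monoˡ-≤ d a≤) (m/n*n≤m x d)

  -- The remainders of `a` and `b` add up to a multiple of `d` that is positive, as `d` does not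
  -- divide `a`, and less than `2 d`; hence to `d` itself.
  /-complement : ∀ {a b} q d .{{_ : NonZero d}} → a + b ≡ q * d → ¬ d ∣ a → 1 + (a / d + b / d) ≡ q
  /-complement {a} {b} q d a+b≡q*d d∤a = *-cancelʳ-≡ _ q d (begin
    (1 + (a / d + b / d)) * d                          ≡⟨ identity d (a / d) (b / d) ⟩
    d + (a / d + b / d) * d                            ≡⟨ cong (_+ (a / d + b / d) * d) remainders ⟨
    (a % d + b % d) + (a / d + b / d) * d              ≡⟨ decomposition ⟨
    a + b                                              ≡⟨ a+b≡q*d ⟩
    q * d                                              ∎)
    where
    open ≡-Reasoning
    identity : ∀ d x y → (1 + (x + y)) * d ≡ d + (x + y) * d
    identity = ℕSolver.solve-∀
    identity′ : ∀ r s x y d → (r + x * d) + (s + y * d) ≡ (r + s) + (x + y) * d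
    identity′ = ℕSolver.solve-∀
    decomposition : a + b ≡ (a % d + b % d) + (a / d + b / d) * d
    decomposition = trans (cong₂ _+_ (m≡m%n+[m/n]*n a d) (m≡m%n+[m/n]*n b d))
                          (identity′ (a % d) (b % d) (a / d) (b / d) d)
    d∣remainders : d ∣ a % d + b % d
    d∣remainders = ∣m+n∣m⇒∣n
      (subst (d ∣_) (trans decomposition (+-comm (a % d + b % d) _)) (divides q a+b≡q*d))
      (divides (a / d + b / d) refl)
    multiple-in-range : ∀ {x} → d ∣ x → x ≢ 0 → x < d + d → x ≡ d
    multiple-in-range (divides 0 refl)             x≢0 _  = contradiction refl x≢0
    multiple-in-range (divides 1 refl)             _   _  = *-identityˡ d
    multiple-in-range (divides (suc (suc e)) refl) _   x< =
      contradiction (+-monoʳ-≤ d (m≤m+n d (e * d))) (<⇒≱ x<)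
    remainders : a % d + b % d ≡ d
    remainders = multiple-in-range d∣remainders
      (λ eq → d∤a (m%n≡0⇒n∣m a d (m+n≡0⇒m≡0 (a % d) eq)))
      (+-mono-< (m%n<n a d) (m%n<n b d))

  -- Eisenstein's lattice point count: the floors count the points (i , j) of the
  -- rectangle below the diagonal by columns, the right-hand side by rows.
  ∑floorSign-reciprocity : ∀ h n → let open HalfSystem h in Coprime (suc n) m →
    ∑[ j < suc h ] floorSign (suc n * toℕ j) ≡
    ∑[ i < n ] (parity h ℙ.+ parity (suc (toℕ i) * m / (2 * suc n)))
  ∑floorSign-reciprocity h n N⊥m = begin
    ∑[ j < suc h ] floorSign (N * toℕ j)
      ≡⟨ cong (ℙ._+ (∑[ j < h ] floorSign (N * suc (toℕ j)))) (floorSign-0 N) ⟩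
    ∑[ j < h ] floorSign (N * suc (toℕ j))
      ≡⟨ sum-cong-≗ {h} (λ j → ∑-multiples≤ n _ m (column-bound j)) ⟨
    ∑[ j < h ] ∑[ i < n ] ⟦ suc (toℕ i) * m ≤ 2 * (N * suc (toℕ j)) ⟧
      ≡⟨ ∑-comm {h} {n} _ ⟩
    ∑[ i < n ] ∑[ j < h ] ⟦ suc (toℕ i) * m ≤ 2 * (N * suc (toℕ j)) ⟧
      ≡⟨ sum-cong-≗ {n} row ⟩
    ∑[ i < n ] (parity h ℙ.+ parity (suc (toℕ i) * m / (2 * N))) ∎
    where
    open ≡-Reasoning
    open HalfSystem h
    N = suc n

    column-bound : ∀ (j : Fin h) → 2 * (N * suc (toℕ j)) < N * m
    column-bound j = subst (_< N * m) (identity N (suc (toℕ j)))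
      (*-monoʳ-< N (s≤s (*-monoʳ-≤ 2 (Fin.toℕ<n j))))
      where
      identity : ∀ N j → N * (2 * j) ≡ 2 * (N * j)
      identity = ℕSolver.solve-∀

    row-bound : ∀ (i : Fin n) → suc (toℕ i) * m < suc h * (2 * N)
    row-bound i = subst (suc (toℕ i) * m <_) (identity N h)
      (*-mono-< (s≤s (Fin.toℕ<n i)) (n<1+n m))
      where
      identity : ∀ N h → N * (2 + 2 * h) ≡ suc h * (2 * N)
      identity = ℕSolver.solve-∀

    -- `N` is coprime to `m` and cannot divide a row index strictly between 0 and `N`. So no lattice
    -- point lies on the diagonal, and the points above it are the complement of those below.
    off-diagonal : ∀ (i : Fin n) (j : Fin h) → suc (toℕ i) * m ≢ 2 * (N * suc (toℕ j))
    off-diagonal i j eq = contradiction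
      (ℕ∣.∣⇒≤ (coprime-divisor N⊥m (divides (2 * suc (toℕ j))
        (trans (*-comm m _) (trans eq (identity N (suc (toℕ j))))))))
      (<⇒≱ (s≤s (Fin.toℕ<n i)))
      where
      identity : ∀ N j → 2 * (N * j) ≡ 2 * j * N
      identity = ℕSolver.solve-∀

    -- Modulo 2, the points on one side of the diagonal number `h` plus those on the other side, and
    -- the latter are counted by the floor.
    row : ∀ (i : Fin n) → ∑[ j < h ] ⟦ suc (toℕ i) * m ≤ 2 * (N * suc (toℕ j)) ⟧ ≡
                          parity h ℙ.+ parity (suc (toℕ i) * m / (2 * N))
    row i = begin
      ∑[ j < h ] ⟦ suc (toℕ i) * m ≤ 2 * (N * suc (toℕ j)) ⟧
        ≡⟨ sum-cong-≗ {h} (λ j → trans (⟦≤⟧-flip (off-diagonal i j))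
             (cong (λ x → 1ℙ ℙ.+ ⟦ x ≤ suc (toℕ i) * m ⟧) (identity N (suc (toℕ j))))) ⟩
      ∑[ j < h ] (1ℙ ℙ.+ ⟦ suc (toℕ j) * (2 * N) ≤ suc (toℕ i) * m ⟧)
        ≡⟨ ∑-distrib-+ {h} (λ _ → 1ℙ) _ ⟩
      (∑[ j < h ] 1ℙ) ℙ.+ ∑[ j < h ] ⟦ suc (toℕ j) * (2 * N) ≤ suc (toℕ i) * m ⟧
        ≡⟨ cong₂ ℙ._+_ (sum-1ℙ h) (∑-multiples≤ h _ (2 * N) (row-bound i)) ⟩
      parity h ℙ.+ parity (suc (toℕ i) * m / (2 * N)) ∎
      where
      identity : ∀ N j → 2 * (N * j) ≡ j * (2 * N)
      identity = ℕSolver.solve-∀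

  -- By `∑floorSign-N` the two floor sums would be congruent to `h` and `h′` modulo 2. Counted by
  -- rows, their total is even, whereas `h + h′ = 2 N k − 1` is odd.
  -N-not-square-mod-both : ∀ {h h′ N k w w′} → h + h′ + 1 ≡ 2 * (N * k) → Coprime N (1 + 2 * h) →
    1 + 2 * h ∣ w * w + N → 1 + 2 * h′ ∣ w′ * w′ + N → ⊥
  -N-not-square-mod-both {h} {h′} {zero} h+h′+1≡0 _ _ _ = contradiction (m+n≡0⇒n≡0 (h + h′) h+h′+1≡0) λ ()
  -N-not-square-mod-both {h} {h′} {suc n} {k} {w} {w′} h+h′+1≡2Nk N⊥m m∣ m′∣ = contradiction odd λ ()
    where
    open ≡-Reasoning
    N = suc n
    m = 1 + 2 * h
    m′ = 1 + 2 * h′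

    m+m′≡ : m + m′ ≡ 2 * k * (2 * N)
    m+m′≡ = trans (identity h h′) (trans (cong (_*_ 2) h+h′+1≡2Nk) (identity′ N k))
      where
      identity : ∀ h h′ → (1 + 2 * h) + (1 + 2 * h′) ≡ 2 * (h + h′ + 1)
      identity = ℕSolver.solve-∀
      identity′ : ∀ N k → 2 * (2 * (N * k)) ≡ 2 * k * (2 * N)
      identity′ = ℕSolver.solve-∀

    N⊥m′ : Coprime N m′
    N⊥m′ {d} (d∣N , d∣m′) = N⊥m (d∣N , ∣m+n∣m⇒∣n
      (subst (d ∣_) (trans (sym m+m′≡) (+-comm m m′)) (ℕ∣.∣n⇒∣m*n (2 * k) (ℕ∣.∣n⇒∣m*n 2 d∣N))) d∣m′)

    row row′ : Fin n → Parity
    row  i = parity h  ℙ.+ parity (suc (toℕ i) * m  / (2 * N))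
    row′ i = parity h′ ℙ.+ parity (suc (toℕ i) * m′ / (2 * N))

    -- For row number `r`, `r m` and `r m′` add up to `2 r k` times `2 N`, so by `/-complement`
    -- their floors have the odd sum `2 r k − 1`, which offsets the odd `h + h′`.
    rows : ∀ i → row i ℙ.+ row′ i ≡ 0ℙ
    rows i = begin
      (parity h ℙ.+ parity q) ℙ.+ (parity h′ ℙ.+ parity q′)
        ≡⟨ cong₂ ℙ._+_ (ℙ.+-homo-+ h q) (ℙ.+-homo-+ h′ q′) ⟨
      parity (h + q) ℙ.+ parity (h′ + q′)
        ≡⟨ ℙ.+-homo-+ (h + q) (h′ + q′) ⟨
      -- `parity` ignores the added 2; one unit completes `h + h′ + 1`, the other `1 + (q + q′)`,
      -- and both of these are even.
      parity (2 + ((h + q) + (h′ + q′)))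
        ≡⟨ cong parity (trans (identity h h′ q q′) (cong₂ _+_ h+h′+1≡2Nk complement)) ⟩
      parity (2 * (N * k) + suc (toℕ i) * (2 * k))
        ≡⟨ cong parity (identity′ (N * k) (suc (toℕ i)) k) ⟩
      parity (2 * (N * k + suc (toℕ i) * k))
        ≡⟨ parity[2*n]≡0ℙ (N * k + suc (toℕ i) * k) ⟩
      0ℙ ∎
      where
      q  = suc (toℕ i) * m / (2 * N)
      q′ = suc (toℕ i) * m′ / (2 * N)
      identity : ∀ h h′ q q′ → 2 + ((h + q) + (h′ + q′)) ≡ (h + h′ + 1) + (1 + (q + q′))
      identity = ℕSolver.solve-∀
      identity′ : ∀ a i k → 2 * a + i * (2 * k) ≡ 2 * (a + i * k)
      identity′ = ℕSolver.solve-∀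
      2N∤ : ¬ 2 * N ∣ suc (toℕ i) * m
      2N∤ 2N∣ = contradiction
        (ℕ∣.∣⇒≤ (coprime-divisor N⊥m (subst (N ∣_) (*-comm _ m) (ℕ∣.m*n∣⇒n∣ 2 N 2N∣))))
        (<⇒≱ (s≤s (Fin.toℕ<n i)))
      complement : 1 + (q + q′) ≡ suc (toℕ i) * (2 * k)
      complement = /-complement (suc (toℕ i) * (2 * k)) (2 * N)
        (trans (sym (*-distribˡ-+ (suc (toℕ i)) m m′))
          (trans (cong (_*_ (suc (toℕ i))) m+m′≡) (sym (*-assoc (suc (toℕ i)) (2 * k) (2 * N))))) 2N∤

    odd : 1ℙ ≡ 0ℙ
    odd = begin
      1ℙ                              ≡⟨ cong (ℙ._+ 1ℙ) even ⟨
      (parity h ℙ.+ parity h′) ℙ.+ 1ℙ ≡⟨ cong (ℙ._+ 1ℙ) (ℙ.+-homo-+ h h′) ⟨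
      parity (h + h′) ℙ.+ 1ℙ          ≡⟨ ℙ.+-homo-+ (h + h′) 1 ⟨
      parity (h + h′ + 1)             ≡⟨ cong parity h+h′+1≡2Nk ⟩
      parity (2 * (N * k))            ≡⟨ parity[2*n]≡0ℙ (N * k) ⟩
      0ℙ                              ∎
      where
      even : parity h ℙ.+ parity h′ ≡ 0ℙ
      even = begin
        parity h ℙ.+ parity h′
          ≡⟨ cong₂ ℙ._+_ (HalfSystem.∑floorSign-N h {w = w} m∣ N⊥m) (HalfSystem.∑floorSign-N h′ {w = w′} m′∣ N⊥m′) ⟨
        (∑[ j < suc h ] HalfSystem.floorSign h (N * toℕ j)) ℙ.+
        (∑[ j < suc h′ ] HalfSystem.floorSign h′ (N * toℕ j))
          ≡⟨ cong₂ ℙ._+_ (∑floorSign-reciprocity h n N⊥m) (∑floorSign-reciprocity h′ n N⊥m′) ⟩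
        sum row ℙ.+ sum row′
          ≡⟨ ∑-distrib-+ row row′ ⟨
        ∑[ i < n ] (row i ℙ.+ row′ i)
          ≡⟨ sum-cong-≗ rows ⟩
        ∑[ i < n ] 0ℙ
          ≡⟨ sum-replicate-zero n ⟩
        0ℙ ∎

-- Arithmetic of the solutions in natural numbers.

module EgyptianFractions where

  open Reciprocity using (-N-not-square-mod-both)

  open import Data.Empty using (⊥)
  open import Data.Nat
  open import Data.Nat.Coprimality using (Coprime; coprime-divisor; coprime-/gcd)
  import Data.Nat.Coprimality as Coprimality
  open import Data.Nat.Divisibility
  open import Data.Nat.DivMod using (m≡m%n+[m/n]*n; m%n<n; m*[n/m]≡n)
  open import Data.Nat.GCD using (gcd; gcd[m,n]∣m; gcd[m,n]∣n; gcd[m,n]≢0)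
  open import Data.Nat.Primality
  open import Data.Nat.Properties
  open import Data.Nat.Tactic.RingSolver using (solve-∀)
  open import Data.Product using (∃; ∃₂; _×_; _,_; proj₁; proj₂)
  open import Data.Sum using (_⊎_; inj₁; inj₂; [_,_]′)
  import Data.Sum as Sum
  open import Function using (_∘_; it)
  open import Relation.Binary.PropositionalEquality
    using (_≡_; refl; sym; trans; cong; cong₂; subst; subst₂; module ≡-Reasoning)
  open import Relation.Nullary using (Dec; yes; no; contradiction)

  2∤⇒odd : ∀ {n} → 2 ∤ n → ∃ λ h → n ≡ 1 + 2 * h
  2∤⇒odd {n} 2∤n with n % 2 | n / 2 | m≡m%n+[m/n]*n n 2 | m%n<n n 2
  ... | 0 | q | eq | _ = contradiction (divides q eq) 2∤n
  ... | 1 | q | eq | _ = q , trans eq (cong suc (*-comm q 2))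
  ... | suc (suc _) | _ | _ | s≤s (s≤s ())

  -- As `p + d` is even and `p` is odd, `d` is odd too; halving the relation gives the one between
  -- `h` and `h′`.
  -N-not-square-mod-both′ : ∀ {p d N} k {w w′} → p + d ≡ 4 * (N * k) → 2 ∤ p → Coprime N p →
    p ∣ w * w + N → d ∣ w′ * w′ + N → ⊥
  -N-not-square-mod-both′ {p} {d} {N} k {w} {w′} p+d≡ 2∤p N⊥p p∣ d∣
    with 2∤⇒odd 2∤p
       | 2∤⇒odd {d} (λ 2∣d → 2∤p (∣m+n∣m⇒∣n
           (subst (2 ∣_) (trans (sym p+d≡) (+-comm p d)) (∣m⇒∣m*n (N * k) (divides 2 refl))) 2∣d))
  ... | h , refl | h′ , refl = -N-not-square-mod-both {h} {h′} {N} {k} {w} {w′} half N⊥p p∣ d∣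
    where
    identity : ∀ h h′ → 2 * (h + h′ + 1) ≡ (1 + 2 * h) + (1 + 2 * h′)
    identity = solve-∀
    half : h + h′ + 1 ≡ 2 * (N * k)
    half = *-cancelˡ-≡ _ _ 2 (trans (identity h h′) (trans p+d≡ (*-assoc 2 2 (N * k))))

  prime∧∤⇒coprime : ∀ {p n} → Prime p → p ∤ n → Coprime p n
  prime∧∤⇒coprime pr p∤n (d∣p , d∣n) with prime⇒irreducible pr d∣p
  ... | inj₁ d≡1  = d≡1
  ... | inj₂ refl = contradiction d∣n p∤n

  ∤-* : ∀ {p m n} → Prime p → p ∤ m → p ∤ n → p ∤ m * n
  ∤-* {m = m} {n} pr p∤m p∤n = [ p∤m , p∤n ]′ ∘ euclidsLemma m n pr

  -- `α / β` equals `a / b` with `a` and `b` prime to `p`, and the two nonsquare conditions say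
  -- without division that neither `−a/b` nor `−b/a` is a square modulo `p`. By `separated`, `p`
  -- divides either `γ` alone or `α` and `β` alone, so no ratio of `γ` with one of these can be a
  -- p-adic unit.
  record NonsquareRatio (p α β γ : ℕ) : Set where
    field
      g a b : ℕ
      α≡ : α ≡ g * a
      β≡ : β ≡ g * b
      p∤a : p ∤ a
      p∤b : p ∤ b
      nonsquare-a/b : ∀ w → p ∤ w * w * b + a
      nonsquare-b/a : ∀ w → p ∤ w * w * a + b
      separated : (p ∤ α × p ∤ β × p ∣ γ) ⊎ (p ∣ α × p ∣ β × p ∤ γ)

  -- Symmetries in the three denominators.

  NonsquareRatio-sym : ∀ {p x y z} → NonsquareRatio p x y z → NonsquareRatio p y x z
  NonsquareRatio-sym r = record
    { g = g ; a = b ; b = a ; α≡ = β≡ ; β≡ = α≡ ; p∤a = p∤b ; p∤b = p∤a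
    ; nonsquare-a/b = nonsquare-b/a ; nonsquare-b/a = nonsquare-a/b
    ; separated = Sum.map (λ (A , B , C) → B , A , C) (λ (A , B , C) → B , A , C) separated
    }
    where open NonsquareRatio r

  SomeNonsquareRatio : (p x y z : ℕ) → Set
  SomeNonsquareRatio p x y z = NonsquareRatio p x y z ⊎ NonsquareRatio p x z y ⊎ NonsquareRatio p y z x

  -- 4/p = 1/x + 1/y + 1/z, cleared of denominators.
  Solution : (p x y z : ℕ) → Set
  Solution p x y z = 4 * (x * y * z) ≡ p * (y * z + x * z + x * y)

  swap₁₂ : ∀ {p x y z} → SomeNonsquareRatio p x y z → SomeNonsquareRatio p y x z
  swap₁₂ (inj₁ r)        = inj₁ (NonsquareRatio-sym r)
  swap₁₂ (inj₂ (inj₁ r)) = inj₂ (inj₂ r)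
  swap₁₂ (inj₂ (inj₂ r)) = inj₂ (inj₁ r)

  swap₁₃ : ∀ {p x y z} → SomeNonsquareRatio p x y z → SomeNonsquareRatio p z y x
  swap₁₃ (inj₁ r)        = inj₂ (inj₂ (NonsquareRatio-sym r))
  swap₁₃ (inj₂ (inj₁ r)) = inj₂ (inj₁ (NonsquareRatio-sym r))
  swap₁₃ (inj₂ (inj₂ r)) = inj₁ (NonsquareRatio-sym r)

  Solution-swap₁₂ : ∀ {p x y z} → Solution p x y z → Solution p y x z
  Solution-swap₁₂ {p} {x} {y} {z} sol = trans (identity x y z) (trans sol (identity′ p x y z))
    where
    identity : ∀ x y z → 4 * (y * x * z) ≡ 4 * (x * y * z)
    identity = solve-∀
    identity′ : ∀ p x y z → p * (y * z + x * z + x * y) ≡ p * (x * z + y * z + y * x)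
    identity′ = solve-∀

  Solution-swap₁₃ : ∀ {p x y z} → Solution p x y z → Solution p z y x
  Solution-swap₁₃ {p} {x} {y} {z} sol = trans (identity x y z) (trans sol (identity′ p x y z))
    where
    identity : ∀ x y z → 4 * (z * y * x) ≡ 4 * (x * y * z)
    identity = solve-∀
    identity′ : ∀ p x y z → p * (y * z + x * z + x * y) ≡ p * (y * x + z * x + z * y)
    identity′ = solve-∀

  module _ {p : ℕ} (pr : Prime p) (2∤p : 2 ∤ p) where

    p∤4 : p ∤ 4
    p∤4 p∣4 = [ p∤2 , p∤2 ]′ (euclidsLemma 2 2 pr p∣4)
      where
      p∤2 : p ∤ 2
      p∤2 p∣2 with prime⇒irreducible prime[2] p∣2
      ... | inj₁ refl = ¬prime[1] pr
      ... | inj₂ refl = 2∤p ∣-refl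

    -- Factorisation of a solution with one denominator prime to `p`.

    module _ {d x : ℕ} (p+d≡4x : p + d ≡ 4 * x) (p∤x : p ∤ x) where

      p∤d : p ∤ d
      p∤d p∣d = ∤-* pr p∤4 p∤x (subst (p ∣_) p+d≡4x (∣m∣n⇒∣m+n ∣-refl p∣d))

      -- A common divisor of `t` and `d` divides `p = 4 x − d`, and it is not `p` because `p` does
      -- not divide `x`.
      ∣x⇒coprime-d : ∀ {t} → t ∣ x → Coprime t d
      ∣x⇒coprime-d t∣x {e} (e∣t , e∣d) with prime⇒irreducible pr e∣p
        where
        e∣p : e ∣ p
        e∣p = ∣m+n∣m⇒∣n (subst (e ∣_) (trans (sym p+d≡4x) (+-comm p d)) (∣n⇒∣m*n 4 (∣-trans e∣t t∣x))) e∣d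
      ... | inj₁ e≡1 = e≡1
      ... | inj₂ refl = contradiction (∣-trans e∣t t∣x) p∤x

      module _ .{{_ : NonZero x}} where

        ∣-cofactor : ∀ {k l m n} → Coprime k m → n * k ≡ l * m → k ∣ l
        ∣-cofactor {k} {l} {m} {n} k⊥m eq = coprime-divisor k⊥m (divides n (trans (*-comm m l) (sym eq)))

        -- Being coprime to `S` and to each other, `b` and `c` jointly divide `x`, with cofactor
        -- `t`. Then `d g = t S`, and `t`, as a divisor of `x`, is coprime to `d` and so divides
        -- `g`.
        factorise : ∀ {g b c S} → Coprime b c → Coprime b S → Coprime c S → d * g * (b * c) ≡ x * S →
                    ∃₂ λ t s → x ≡ c * (b * t) × g ≡ s * t × d * s ≡ S
        factorise {g} {b} {c} {S} b⊥c b⊥S c⊥S eq = t , s , x≡cbt , g≡st , ds≡S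
          where
          open ≡-Reasoning
          c∣x : c ∣ x
          c∣x = ∣-cofactor {n = d * g * b} c⊥S (trans (*-assoc (d * g) b c) eq)
          q = quotient c∣x
          x≡cq : x ≡ c * q
          x≡cq = trans (m∣n⇒n≡quotient*m c∣x) (*-comm q c)
          b∣q : b ∣ q
          b∣q = coprime-divisor b⊥c (subst (b ∣_) x≡cq
            (∣-cofactor {n = d * g * c} b⊥S (trans (identity (d * g) b c) eq)))
            where
            identity : ∀ n b c → n * c * b ≡ n * (b * c)
            identity = solve-∀
          t = quotient b∣q
          x≡cbt : x ≡ c * (b * t)
          x≡cbt = trans x≡cq (cong (c *_) (trans (m∣n⇒n≡quotient*m b∣q) (*-comm t b)))
          instance
            bt≢0 = m*n≢0⇒n≢0 c {{subst NonZero x≡cbt it}}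
            t≢0 = m*n≢0⇒n≢0 b {{bt≢0}}
            b≢0 = m*n≢0⇒m≢0 b {{bt≢0}}
            c≢0 = m*n≢0⇒m≢0 c {{subst NonZero x≡cbt it}}
            bc≢0 = m*n≢0 b c
          dg≡tS : d * g ≡ t * S
          dg≡tS = *-cancelˡ-≡ _ _ (b * c) (begin
            b * c * (d * g)       ≡⟨ *-comm (b * c) (d * g) ⟩
            d * g * (b * c)       ≡⟨ eq ⟩
            x * S                 ≡⟨ cong (_* S) x≡cbt ⟩
            c * (b * t) * S       ≡⟨ identity b c t S ⟩
            b * c * (t * S)       ∎)
            where
            identity : ∀ b c t S → c * (b * t) * S ≡ b * c * (t * S)
            identity = solve-∀
          t⊥d : Coprime t d
          t⊥d = ∣x⇒coprime-d (divides (c * b) (trans x≡cbt (sym (*-assoc c b t))))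
          t∣g : t ∣ g
          t∣g = coprime-divisor t⊥d (divides S (trans dg≡tS (*-comm t S)))
          s = quotient t∣g
          g≡st : g ≡ s * t
          g≡st = m∣n⇒n≡quotient*m t∣g
          ds≡S : d * s ≡ S
          ds≡S = *-cancelˡ-≡ _ _ t (begin
            t * (d * s)   ≡⟨ identity t d s ⟩
            d * (s * t)   ≡⟨ cong (d *_) g≡st ⟨
            d * g         ≡⟨ dg≡tS ⟩
            t * S         ∎)
            where
            identity : ∀ t d s → t * (d * s) ≡ d * (s * t)
            identity = solve-∀

        -- The case `N = b c`: `w² c + b` times `c` is `(w c)² + b c`, while `b² + b c = b (d s)`
        -- makes `−N` a square modulo `d`.
        factorisation⇒ratio₂ : ∀ {g b c t s} → p ∤ b → p ∤ c → p ∣ g →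
          x ≡ c * (b * t) → d * s ≡ b + c → NonsquareRatio p (g * b) (g * c) x
        factorisation⇒ratio₂ {g} {b} {c} {t} {s} p∤b p∤c p∣g x≡cbt ds≡b+c = record
          { g = g ; a = b ; b = c
          ; α≡ = refl ; β≡ = refl
          ; p∤a = p∤b ; p∤b = p∤c
          ; nonsquare-a/b = λ w p∣w²c+b → nonsquare (w * c) (subst (p ∣_) (identity₁ w b c) (∣n⇒∣m*n c p∣w²c+b))
          ; nonsquare-b/a = λ w p∣w²b+c → nonsquare (w * b) (subst (p ∣_) (identity₂ w b c) (∣n⇒∣m*n b p∣w²b+c))
          ; separated = inj₂ (∣m⇒∣m*n b p∣g , ∣m⇒∣m*n c p∣g , p∤x)
          }
          where
          identity₁ : ∀ w b c → c * (w * w * c + b) ≡ w * c * (w * c) + b * c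
          identity₁ = solve-∀
          identity₂ : ∀ w b c → b * (w * w * b + c) ≡ w * b * (w * b) + b * c
          identity₂ = solve-∀
          p+d≡ : p + d ≡ 4 * (b * c * t)
          p+d≡ = trans p+d≡4x (cong (4 *_) (trans x≡cbt (identity b c t)))
            where
            identity : ∀ b c t → c * (b * t) ≡ b * c * t
            identity = solve-∀
          d∣b²+bc : d ∣ b * b + b * c
          d∣b²+bc = divides (b * s) (trans (sym (*-distribˡ-+ b b c)) (trans (cong (b *_) (sym ds≡b+c)) (identity b d s)))
            where
            identity : ∀ b d s → b * (d * s) ≡ b * s * d
            identity = solve-∀
          nonsquare : ∀ w → p ∤ w * w + b * c
          nonsquare w p∣ = -N-not-square-mod-both′ t {w} {b} p+d≡ 2∤p
            (Coprimality.sym (prime∧∤⇒coprime pr (∤-* pr p∤b p∤c))) p∣ d∣b²+bc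

        -- `p` divides `d g b c` but none of `d`, `b` and `c`, so it divides `g`; cancelling it
        -- leaves an equation for `factorise` with `S = b + c`.
        ratio-both-divisible : ∀ {g b c} → Coprime b c → p ∤ b → p ∤ c →
          d * g * (b * c) ≡ p * x * (b + c) → NonsquareRatio p (g * b) (g * c) x
        ratio-both-divisible {g} {b} {c} b⊥c p∤b p∤c eq =
          let t , s , x≡cbt , _ , ds≡b+c = factorise {g′} {b} {c} {b + c} b⊥c b⊥b+c c⊥b+c eq′
          in factorisation⇒ratio₂ {g} {b} {c} {t} {s} p∤b p∤c p∣g x≡cbt ds≡b+c
          where
          p∣g : p ∣ g
          p∣g = [ (λ p∣dg → [ (λ p∣d → contradiction p∣d p∤d) , (λ p∣g → p∣g) ]′ (euclidsLemma d g pr p∣dg))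
                , (λ p∣bc → contradiction p∣bc (∤-* pr p∤b p∤c)) ]′
                (euclidsLemma (d * g) (b * c) pr (divides (x * (b + c)) (trans eq (identity p x (b + c)))))
            where
            identity : ∀ p x S → p * x * S ≡ x * S * p
            identity = solve-∀
          g′ = quotient p∣g
          b⊥b+c : Coprime b (b + c)
          b⊥b+c (e∣b , e∣b+c) = b⊥c (e∣b , ∣m+n∣m⇒∣n e∣b+c e∣b)
          c⊥b+c : Coprime c (b + c)
          c⊥b+c {e} (e∣c , e∣b+c) = b⊥c (∣m+n∣m⇒∣n (subst (e ∣_) (+-comm b c) e∣b+c) e∣c , e∣c)
          eq′ : d * g′ * (b * c) ≡ x * (b + c)
          eq′ = *-cancelˡ-≡ _ _ p {{prime⇒nonZero pr}}
            (trans (identity p d g′ (b * c)) (trans (cong (λ n → d * n * (b * c)) (sym (m∣n⇒n≡quotient*m p∣g)))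
              (trans eq (*-assoc p x (b + c)))))
            where
            identity : ∀ p d g S → p * (d * g * S) ≡ d * (g * p) * S
            identity = solve-∀

        -- The case `N = t`: once the common factor `c t` is removed, `x` and `s t c` become `b` and
        -- `s`. Since `4 s t b ≡ 1` modulo `p`, `−b/s` and `−t` differ by a square factor.
        factorisation⇒ratio₁ : ∀ {b c t s} → x ≡ c * (b * t) → d * s ≡ b * p + c →
                              NonsquareRatio p x (s * t * c) (s * t * (b * p))
        factorisation⇒ratio₁ {b} {c} {t} {s} x≡cbt ds≡S = record
          { g = c * t ; a = b ; b = s
          ; α≡ = trans x≡cbt (identity₁ c b t) ; β≡ = identity₂ s t c
          ; p∤a = p∤b ; p∤b = p∤s
          ; nonsquare-a/b = λ w p∣ → nonsquare (2 * w * t * s) (transfer s b w cong-s p∣)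
          ; nonsquare-b/a = λ w p∣ → nonsquare (2 * w * t * b) (transfer b s w cong-b p∣)
          ; separated = inj₁ (p∤x , ∤-* pr (∤-* pr p∤s p∤t) p∤c , ∣n⇒∣m*n (s * t) (∣n⇒∣m*n b ∣-refl))
          }
          where
          identity₁ : ∀ c b t → c * (b * t) ≡ c * t * b
          identity₁ = solve-∀
          identity₂ : ∀ s t c → s * t * c ≡ c * t * s
          identity₂ = solve-∀
          p∤c : p ∤ c
          p∤c p∣c = p∤x (subst (p ∣_) (sym x≡cbt) (∣m⇒∣m*n (b * t) p∣c))
          p∤b : p ∤ b
          p∤b p∣b = p∤x (subst (p ∣_) (sym x≡cbt) (∣n⇒∣m*n c (∣m⇒∣m*n t p∣b)))
          p∤t : p ∤ t
          p∤t p∣t = p∤x (subst (p ∣_) (sym x≡cbt) (∣n⇒∣m*n c (∣n⇒∣m*n b p∣t)))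
          p∤s : p ∤ s
          p∤s p∣s = p∤c (∣m+n∣m⇒∣n (subst (p ∣_) ds≡S (∣n⇒∣m*n d p∣s)) (∣n⇒∣m*n b ∣-refl))

          p+d≡ : p + d ≡ 4 * (t * (b * c))
          p+d≡ = trans p+d≡4x (cong (4 *_) (trans x≡cbt (identity b c t)))
            where
            identity : ∀ b c t → c * (b * t) ≡ t * (b * c)
            identity = solve-∀

          -- Modulo `d`, `p ≡ 4 t b c`, so `0 ≡ b p + c ≡ c (4 b² t + 1)`. Here `c` can be
          -- cancelled, and multiplying by `t` completes the square.
          d∣[2bt]²+t : d ∣ (2 * b * t) * (2 * b * t) + t
          d∣[2bt]²+t = subst (d ∣_) (identity b t) (∣n⇒∣m*n t
            (coprime-divisor (Coprimality.sym c⊥d) (divides (b + s) (begin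
              c * (4 * b * b * t + 1)           ≡⟨ identity₃ c b t ⟩
              b * (4 * (t * (b * c))) + c       ≡⟨ cong (λ n → b * n + c) p+d≡ ⟨
              b * (p + d) + c                    ≡⟨ identity₄ b p d c ⟩
              b * d + (b * p + c)               ≡⟨ cong (b * d +_) ds≡S ⟨
              b * d + d * s                      ≡⟨ identity₅ b d s ⟩
              (b + s) * d                        ∎))))
            where
            open ≡-Reasoning
            c⊥d : Coprime c d
            c⊥d = ∣x⇒coprime-d (divides (b * t) (trans x≡cbt (*-comm c (b * t))))
            identity : ∀ b t → t * (4 * b * b * t + 1) ≡ 2 * b * t * (2 * b * t) + t
            identity = solve-∀
            identity₃ : ∀ c b t → c * (4 * b * b * t + 1) ≡ b * (4 * (t * (b * c))) + c
            identity₃ = solve-∀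
            identity₄ : ∀ b p d c → b * (p + d) + c ≡ b * d + (b * p + c)
            identity₄ = solve-∀
            identity₅ : ∀ b d s → b * d + d * s ≡ (b + s) * d
            identity₅ = solve-∀

          -- Both sides equal `(p + d) s`; as `p` does not divide `c`, the equation says that
          -- `4 s t b ≡ 1` modulo `p`.
          cong-s : c * (4 * (s * (t * b))) ≡ p * (s + b) + c
          cong-s = begin
            c * (4 * (s * (t * b)))      ≡⟨ identity c s t b ⟩
            4 * (t * (b * c)) * s        ≡⟨ cong (_* s) p+d≡ ⟨
            (p + d) * s                   ≡⟨ *-distribʳ-+ s p d ⟩
            p * s + d * s                 ≡⟨ cong (p * s +_) ds≡S ⟩
            p * s + (b * p + c)          ≡⟨ identity′ p s b c ⟩
            p * (s + b) + c              ∎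
            where
            open ≡-Reasoning
            identity : ∀ c s t b → c * (4 * (s * (t * b))) ≡ 4 * (t * (b * c)) * s
            identity = solve-∀
            identity′ : ∀ p s b c → p * s + (b * p + c) ≡ p * (s + b) + c
            identity′ = solve-∀

          cong-b : c * (4 * (b * (t * s))) ≡ p * (b + s) + c
          cong-b = trans (identity c b t s) (trans cong-s (cong (λ n → p * n + c) (+-comm s b)))
            where
            identity : ∀ c b t s → c * (4 * (b * (t * s))) ≡ c * (4 * (s * (t * b)))
            identity = solve-∀

          -- 4ktl ≡ 1 modulo p, so w²k ≡ -l amounts to (2wtk)² ≡ -t.
          transfer : ∀ k l w → c * (4 * (k * (t * l))) ≡ p * (k + l) + c → p ∣ w * w * k + l →
                     p ∣ (2 * w * t * k) * (2 * w * t * k) + t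
          transfer k l w eq p∣ = [ (λ p∣c → contradiction p∣c p∤c) , (λ p∣v → p∣v) ]′
            (euclidsLemma c _ pr (∣m+n∣m⇒∣n (subst (p ∣_) sum≡ (∣n⇒∣m*n (c * (4 * t * t * k)) p∣))
                                            (∣n⇒∣m*n t (∣m⇒∣m*n (k + l) ∣-refl))))
            where
            open ≡-Reasoning
            identity : ∀ c t k w l → c * (4 * t * t * k) * (w * w * k + l) ≡
                       t * (c * (4 * (k * (t * l)))) + c * ((2 * w * t * k) * (2 * w * t * k))
            identity = solve-∀
            identity′ : ∀ t n c v → t * (n + c) + c * v ≡ t * n + c * (v + t)
            identity′ = solve-∀
            sum≡ : c * (4 * t * t * k) * (w * w * k + l) ≡
                   t * (p * (k + l)) + c * ((2 * w * t * k) * (2 * w * t * k) + t)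
            sum≡ = trans (identity c t k w l) (trans
              (cong (λ n → t * n + c * ((2 * w * t * k) * (2 * w * t * k))) eq)
              (identity′ t (p * (k + l)) c ((2 * w * t * k) * (2 * w * t * k))))

          nonsquare : ∀ w → p ∤ w * w + t
          nonsquare w p∣ = -N-not-square-mod-both′ (b * c) {w} {2 * b * t} p+d≡ 2∤p
            (Coprimality.sym (prime∧∤⇒coprime pr p∤t)) p∣ d∣[2bt]²+t

        -- The factor `p` of `b p` cancels against the one on the right, and `b` and `c` are coprime
        -- to `S = b p + c`, as `factorise` requires.
        ratio-one-divisible : ∀ {g b c} → Coprime (b * p) c →
          d * g * (b * p * c) ≡ p * x * (b * p + c) → NonsquareRatio p x (g * c) (g * (b * p))
        ratio-one-divisible {g} {b} {c} bp⊥c eq =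
          let t , s , x≡cbt , g≡st , ds≡S = factorise {g} {b} {c} {b * p + c} b⊥c b⊥S c⊥S eq′
          in subst (λ g → NonsquareRatio p x (g * c) (g * (b * p))) (sym g≡st)
               (factorisation⇒ratio₁ {b} {c} {t} {s} x≡cbt ds≡S)
          where
          b⊥c : Coprime b c
          b⊥c (e∣b , e∣c) = bp⊥c (∣m⇒∣m*n p e∣b , e∣c)
          b⊥S : Coprime b (b * p + c)
          b⊥S (e∣b , e∣S) = b⊥c (e∣b , ∣m+n∣m⇒∣n e∣S (∣m⇒∣m*n p e∣b))
          c⊥S : Coprime c (b * p + c)
          c⊥S {e} (e∣c , e∣S) = bp⊥c (∣m+n∣m⇒∣n (subst (e ∣_) (+-comm (b * p) c) e∣S) e∣c , e∣c)
          eq′ : d * g * (b * c) ≡ x * (b * p + c)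
          eq′ = *-cancelˡ-≡ _ _ p {{prime⇒nonZero pr}}
            (trans (identity p (d * g) b c) (trans eq (*-assoc p x (b * p + c))))
            where
            identity : ∀ p n b c → p * (n * (b * c)) ≡ n * (b * p * c)
            identity = solve-∀

    -- Size of the smallest denominator and the case distinction.

    module _ {x y z : ℕ} .{{_ : NonZero x}} .{{_ : NonZero y}} .{{_ : NonZero z}} where

      -- `1/x` is the largest of the three fractions, so `1/x < 4/p ≤ 3/x`, which gives `p < 4 x`
      -- and `4 x ≤ 3 p < 4 p`.
      solution-bounds : x ≤ y → x ≤ z → Solution p x y z → p < 4 * x × x < p
      solution-bounds x≤y x≤z sol =
        *-cancelʳ-< (y * z) p (4 * x) lower , *-cancelˡ-< 4 x p (≤-<-trans upper (*-monoˡ-< p (n<1+n 3)))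
        where
        instance
          _ = prime⇒nonZero pr
          _ = m*n≢0 y z
          _ = m*n≢0 x y
          _ = m*n≢0 x z
        open ≤-Reasoning
        sol′ : 4 * x * (y * z) ≡ p * (y * z + x * z + x * y)
        sol′ = trans (identity x y z) sol
          where
          identity : ∀ x y z → 4 * x * (y * z) ≡ 4 * (x * y * z)
          identity = solve-∀
        lower : p * (y * z) < 4 * x * (y * z)
        lower = begin-strict
          p * (y * z)                       <⟨ *-monoʳ-< p (m<m+n (y * z) (>-nonZero⁻¹ (x * z))) ⟩
          p * (y * z + x * z)               ≤⟨ *-monoʳ-≤ p (m≤m+n _ (x * y)) ⟩
          p * (y * z + x * z + x * y)       ≡⟨ sol′ ⟨
          4 * x * (y * z)                   ∎
        upper : 4 * x ≤ 3 * p
        upper = *-cancelʳ-≤ (4 * x) (3 * p) (y * z) (begin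
          4 * x * (y * z)                   ≡⟨ sol′ ⟩
          p * (y * z + x * z + x * y)       ≤⟨ *-monoʳ-≤ p (+-mono-≤ (+-monoʳ-≤ (y * z) (*-monoˡ-≤ z x≤y)) (*-monoˡ-≤ y x≤z)) ⟩
          p * (y * z + y * z + z * y)       ≡⟨ identity p y z ⟩
          3 * p * (y * z)                   ∎)
          where
          identity : ∀ p y z → p * (y * z + y * z + z * y) ≡ 3 * p * (y * z)
          identity = solve-∀

      some-ratio-of-minimal : x ≤ y → x ≤ z → Solution p x y z → SomeNonsquareRatio p x y z
      some-ratio-of-minimal x≤y x≤z sol = subst₂ (SomeNonsquareRatio p x) (sym y≡gb) (sym z≡gc) (cases (p ∣? b) (p ∣? c))
        where
        open ≡-Reasoning
        d = 4 * x ∸ p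
        p+d≡4x : p + d ≡ 4 * x
        p+d≡4x = m+[n∸m]≡n (<⇒≤ (proj₁ (solution-bounds x≤y x≤z sol)))
        p∤x : p ∤ x
        p∤x = >⇒∤ (proj₂ (solution-bounds x≤y x≤z sol))
        g = gcd y z
        instance
          g≢0 : NonZero g
          g≢0 = ≢-nonZero (gcd[m,n]≢0 y z (inj₁ (≢-nonZero⁻¹ y)))
        b = y / g
        c = z / g
        b⊥c : Coprime b c
        b⊥c = coprime-/gcd y z
        y≡gb : y ≡ g * b
        y≡gb = sym (m*[n/m]≡n (gcd[m,n]∣m y z))
        z≡gc : z ≡ g * c
        z≡gc = sym (m*[n/m]≡n (gcd[m,n]∣n y z))

        -- This is `4/p − 1/x = 1/y + 1/z`, that is `d/(p x) = (b + c)/(g b c)`, cleared of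
        -- denominators.
        eq : d * g * (b * c) ≡ p * x * (b + c)
        eq = *-cancelˡ-≡ _ _ g (+-cancelˡ-≡ (p * (g * b * (g * c))) _ _ (begin
          p * (g * b * (g * c)) + g * (d * g * (b * c))     ≡⟨ identity₁ p d g b c ⟩
          (p + d) * (g * b * (g * c))                       ≡⟨ cong₂ (λ n m → n * m) p+d≡4x (cong₂ _*_ (sym y≡gb) (sym z≡gc)) ⟩
          4 * x * (y * z)                                   ≡⟨ identity₂ x y z ⟩
          4 * (x * y * z)                                   ≡⟨ sol ⟩
          p * (y * z + x * z + x * y)                       ≡⟨ cong₂ (λ y z → p * (y * z + x * z + x * y)) y≡gb z≡gc ⟩
          p * (g * b * (g * c) + x * (g * c) + x * (g * b)) ≡⟨ identity₃ p x g b c ⟩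
          p * (g * b * (g * c)) + g * (p * x * (b + c))     ∎))
          where
          identity₁ : ∀ p d g b c → p * (g * b * (g * c)) + g * (d * g * (b * c)) ≡ (p + d) * (g * b * (g * c))
          identity₁ = solve-∀
          identity₂ : ∀ x y z → 4 * x * (y * z) ≡ 4 * (x * y * z)
          identity₂ = solve-∀
          identity₃ : ∀ p x g b c → p * (g * b * (g * c) + x * (g * c) + x * (g * b)) ≡
                      p * (g * b * (g * c)) + g * (p * x * (b + c))
          identity₃ = solve-∀

        one-divisible : ∀ {b c} → Coprime b c → p ∣ b → d * g * (b * c) ≡ p * x * (b + c) →
                        NonsquareRatio p x (g * c) (g * b)
        one-divisible b⊥c (divides b′ refl) = ratio-one-divisible p+d≡4x p∤x {b = b′} b⊥c

        -- The coprime `b` and `c` are not both divisible by `p`. If one is, the partner of `x` is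
        -- the denominator belonging to the other; if neither is, the pair consists of `y` and `z`.
        cases : Dec (p ∣ b) → Dec (p ∣ c) → SomeNonsquareRatio p x (g * b) (g * c)
        cases (yes p∣b) _         = inj₂ (inj₁ (one-divisible b⊥c p∣b eq))
        cases (no _)    (yes p∣c) = inj₁ (one-divisible (Coprimality.sym b⊥c) p∣c
          (trans (cong (d * g *_) (*-comm c b)) (trans eq (cong (p * x *_) (+-comm b c)))))
        cases (no p∤b)  (no p∤c)  = inj₂ (inj₂ (ratio-both-divisible p+d≡4x p∤x b⊥c p∤b p∤c eq))

    some-ratio : ∀ x y z .{{_ : NonZero x}} .{{_ : NonZero y}} .{{_ : NonZero z}} →
                 Solution p x y z → SomeNonsquareRatio p x y z
    some-ratio x y z sol with ≤-total x y | ≤-total x z | ≤-total y z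
    ... | inj₁ x≤y | inj₁ x≤z | _        = some-ratio-of-minimal x≤y x≤z sol
    ... | inj₂ y≤x | _        | inj₁ y≤z = swap₁₂ (some-ratio-of-minimal y≤x y≤z (Solution-swap₁₂ {p} {x} {y} sol))
    ... | inj₁ x≤y | inj₂ z≤x | _        =
      swap₁₃ (some-ratio-of-minimal (≤-trans z≤x x≤y) z≤x (Solution-swap₁₃ {p} {x} {y} sol))
    ... | inj₂ y≤x | _        | inj₂ z≤y =
      swap₁₃ (some-ratio-of-minimal z≤y (≤-trans z≤y y≤x) (Solution-swap₁₃ {p} {x} {y} sol))

-- Ratios of denominators as p-adic units.

module PAdicRatios where

  open EgyptianFractions

  open import Data.Nat using (ℕ; zero; suc; NonZero; _^_)
  import Data.Nat as ℕ
  import Data.Nat.Properties as ℕ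
  import Data.Nat.Divisibility as ℕ
  open import Data.Nat.GCD using (gcd; gcd[m,n]∣m; gcd[m,n]∣n; gcd[m,n]≢0; n/gcd[m,n]≢0; module Bézout)
  open import Data.Nat.DivMod using (m*[n/m]≡n)
  open import Data.Nat.Coprimality using (Coprime; coprime-Bézout; coprime-/gcd)
  import Data.Nat.Coprimality as Coprimality
  open import Data.Nat.Primality using (Prime; ¬prime[1])
  import Data.Nat.Tactic.RingSolver as ℕSolver
  open import Data.Integer using (ℤ; +_; -_; _+_; _-_; _*_; 0ℤ; 1ℤ; -1ℤ; sign; ∣_∣)
  open import Data.Integer.Properties
  open import Data.Integer.Divisibility.Signed
  open import Data.Integer.Tactic.RingSolver using (solve-∀)
  open import Data.Rational as ℚ using (ℚ; ↥_; ↧_)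
  import Data.Rational.Properties as ℚ
  import Data.Rational.Unnormalised as ℚᵘ
  import Data.Rational.Unnormalised.Properties as ℚᵘ
  open import Data.Fin using (Fin; toℕ)
  open import Data.Product using (∃; ∃₂; _×_; _,_; proj₁; proj₂; swap)
  open import Data.Sum using (_⊎_; inj₁; inj₂)
  open import Function using (it)
  open import Relation.Binary.PropositionalEquality
  open import Relation.Nullary using (¬_; yes; no; contradiction)

  -- Equality of unnormalised rationals is cross-multiplication, so the equation is moved there
  -- before the denominators are cleared.
  equation⇒Solution : ∀ p x y z →
    .{{_ : NonZero p}} .{{_ : NonZero x}} .{{_ : NonZero y}} .{{_ : NonZero z}} →
    + 4 ℚ./ p ≡ + 1 ℚ./ x ℚ.+ + 1 ℚ./ y ℚ.+ + 1 ℚ./ z → Solution p x y z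
  equation⇒Solution p@(suc _) x@(suc _) y@(suc _) z@(suc _) eq =
    trans (+-injective (ℚᵘ.drop-*≡* unnormalised)) (identity p x y z)
    where
    identity : ∀ p x y z → ((1 ℕ.* y ℕ.+ 1 ℕ.* x) ℕ.* z ℕ.+ 1 ℕ.* (x ℕ.* y)) ℕ.* p ≡
                           p ℕ.* (y ℕ.* z ℕ.+ x ℕ.* z ℕ.+ x ℕ.* y)
    identity = ℕSolver.solve-∀
    unnormalised : + 4 ℚᵘ./ p ℚᵘ.≃ + 1 ℚᵘ./ x ℚᵘ.+ + 1 ℚᵘ./ y ℚᵘ.+ + 1 ℚᵘ./ z
    unnormalised = ℚᵘ.≃-trans (ℚᵘ.≃-sym (ℚ.toℚᵘ-fromℚᵘ (+ 4 ℚᵘ./ p))) (ℚᵘ.≃-trans (ℚ.toℚᵘ-cong eq)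
      (ℚᵘ.≃-trans (ℚ.toℚᵘ-homo-+ (+ 1 ℚ./ x ℚ.+ + 1 ℚ./ y) (+ 1 ℚ./ z)) (ℚᵘ.+-cong
        (ℚᵘ.≃-trans (ℚ.toℚᵘ-homo-+ (+ 1 ℚ./ x) (+ 1 ℚ./ y))
          (ℚᵘ.+-cong (ℚ.toℚᵘ-fromℚᵘ (+ 1 ℚᵘ./ x)) (ℚ.toℚᵘ-fromℚᵘ (+ 1 ℚᵘ./ y))))
        (ℚ.toℚᵘ-fromℚᵘ (+ 1 ℚᵘ./ z)))))

  -- Natural numbers are used so that coprimality and divisibility by `p` apply directly;
  -- `num*v≡den*u` ties the reduced fraction to `u / v`, which may be unreduced.
  record LowestTerms (u v : ℕ) (q : ℚ) : Set where
    field
      num den    : ℕ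
      ↥≡         : ↥ q ≡ + num
      ↧≡         : ↧ q ≡ + den
      coprime    : Coprime num den
      num*v≡den*u : num ℕ.* v ≡ den ℕ.* u

    common-factor : ∀ g {a b} .{{_ : NonZero v}} → u ≡ g ℕ.* a → v ≡ g ℕ.* b → num ℕ.* b ≡ den ℕ.* a
    common-factor g {a} {b} u≡ga v≡gb = ℕ.*-cancelˡ-≡ _ _ g {{ℕ.m*n≢0⇒m≢0 g {{subst NonZero v≡gb it}}}} (begin
      g ℕ.* (num ℕ.* b)     ≡⟨ identity g num b ⟩
      num ℕ.* (g ℕ.* b)     ≡⟨ cong (num ℕ.*_) v≡gb ⟨
      num ℕ.* v             ≡⟨ num*v≡den*u ⟩
      den ℕ.* u             ≡⟨ cong (den ℕ.*_) u≡ga ⟩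
      den ℕ.* (g ℕ.* a)     ≡⟨ identity g den a ⟨
      g ℕ.* (den ℕ.* a)     ∎)
      where
      open ≡-Reasoning
      identity : ∀ g n b → g ℕ.* (n ℕ.* b) ≡ n ℕ.* (g ℕ.* b)
      identity = ℕSolver.solve-∀

  lowestTerms : ∀ u v .{{_ : NonZero v}} → LowestTerms u v (+ u ℚ./ v)
  lowestTerms u v = record
    { num = u ℕ./ g ; den = v ℕ./ g
    ; ↥≡ = ℚ.↥-mkℚ+ (u ℕ./ g) (v ℕ./ g) ; ↧≡ = ℚ.↧-mkℚ+ (u ℕ./ g) (v ℕ./ g)
    ; coprime = coprime-/gcd u v
    ; num*v≡den*u = begin
        u ℕ./ g ℕ.* v                    ≡⟨ cong (u ℕ./ g ℕ.*_) (m*[n/m]≡n (gcd[m,n]∣n u v)) ⟨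
        u ℕ./ g ℕ.* (g ℕ.* (v ℕ./ g))    ≡⟨ identity (u ℕ./ g) g (v ℕ./ g) ⟩
        v ℕ./ g ℕ.* (g ℕ.* (u ℕ./ g))    ≡⟨ cong (v ℕ./ g ℕ.*_) (m*[n/m]≡n (gcd[m,n]∣m u v)) ⟩
        v ℕ./ g ℕ.* u                    ∎
    }
    where
    open ≡-Reasoning
    g = gcd u v
    instance
      g≢0   = ℕ.≢-nonZero (gcd[m,n]≢0 u v (inj₂ (ℕ.≢-nonZero⁻¹ v)))
      v/g≢0 = ℕ.≢-nonZero (n/gcd[m,n]≢0 u v)
    identity : ∀ a g b → a ℕ.* (g ℕ.* b) ≡ b ℕ.* (g ℕ.* a)
    identity = ℕSolver.solve-∀

  coprime⇒inverse : ∀ {m n} → Coprime m n → ∃ λ e → + n ∣ + m * e - 1ℤ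
  coprime⇒inverse {m} {n} m⊥n with coprime-Bézout m⊥n
  ... | Bézout.+- x y eq = + x , divides (+ y) (begin
    + m * + x - 1ℤ             ≡⟨ cong (_- 1ℤ) (trans (*-comm (+ m) (+ x)) (sym (pos-* x m))) ⟩
    + (x ℕ.* m) - 1ℤ           ≡⟨ cong (λ k → + k - 1ℤ) eq ⟨
    + (1 ℕ.+ y ℕ.* n) - 1ℤ     ≡⟨ cong (λ k → 1ℤ + k - 1ℤ) (pos-* y n) ⟩
    1ℤ + + y * + n - 1ℤ        ≡⟨ identity (+ y * + n) ⟩
    + y * + n                  ∎)
    where
    open ≡-Reasoning
    identity : ∀ k → 1ℤ + k - 1ℤ ≡ k
    identity = solve-∀
  ... | Bézout.-+ x y eq = - + x , divides (- + y) (begin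
    + m * - + x - 1ℤ           ≡⟨ identity (+ m) (+ x) ⟩
    - (1ℤ + + x * + m)         ≡⟨ cong (λ k → - (1ℤ + k)) (pos-* x m) ⟨
    - + (1 ℕ.+ x ℕ.* m)        ≡⟨ cong (λ k → - + k) eq ⟩
    - + (y ℕ.* n)              ≡⟨ cong -_ (pos-* y n) ⟩
    - (+ y * + n)              ≡⟨ neg-distribˡ-* (+ y) (+ n) ⟩
    - + y * + n                ∎)
    where
    open ≡-Reasoning
    identity : ∀ m x → m * - x - 1ℤ ≡ - (1ℤ + x * m)
    identity = solve-∀

  coprime-^ : ∀ {m n} k → Coprime m n → Coprime m (n ^ k)
  coprime-^         zero    m⊥n (_ , d∣1)        = ℕ.∣1⇒≡1 d∣1
  coprime-^ {m} {n} (suc k) m⊥n {d} (d∣m , d∣nnᵏ) = coprime-^ k m⊥n (d∣m , Coprimality.coprime-divisor d⊥n d∣nnᵏ)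
    where
    d⊥n : Coprime d n
    d⊥n (e∣d , e∣n) = m⊥n (ℕ.∣-trans e∣d d∣m , e∣n)

  ∣*⇒∣ : ∀ {m n} a → Coprime m n → + m ∣ + n * a → + m ∣ a
  ∣*⇒∣ {m} {n} a m⊥n m∣na = ∣ᵤ⇒∣ (Coprimality.coprime-divisor m⊥n
    (subst (m ℕ.∣_) (abs-* (+ n) a) (∣⇒∣ᵤ m∣na)))

  module _ {p : ℕ} where

    -- For each `k` Bézout's identity supplies some inverse of `m` modulo `p ^ k`; these choices are
    -- compatible because inverses modulo `p ^ k` are unique.
    inverse : ∀ {m} → Coprime m p → ℤₚ p
    inverse {m} m⊥p .approx k = proj₁ (coprime⇒inverse (coprime-^ k m⊥p))
    inverse {m} m⊥p .compatible k = ∣*⇒∣ _ (Coprimality.sym (coprime-^ k m⊥p))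
      (subst (_ ∣_) (identity (+ m) (e (suc k)) (e k))
        (∣m∣n⇒∣m-n (∣-trans (divides (+ p) (pos-* p (p ^ k))) (proj₂ (coprime⇒inverse (coprime-^ (suc k) m⊥p))))
                   (proj₂ (coprime⇒inverse (coprime-^ k m⊥p)))))
      where
      e : ℕ → ℤ
      e k = proj₁ (coprime⇒inverse (coprime-^ k m⊥p))
      identity : ∀ m a b → (m * a - 1ℤ) - (m * b - 1ℤ) ≡ m * (a - b)
      identity = solve-∀

    m*inverse≈1 : ∀ {m} (m⊥p : Coprime m p) → fromℤ (+ m) · inverse m⊥p ≈ fromℤ 1ℤ
    m*inverse≈1 m⊥p k = proj₂ (coprime⇒inverse (coprime-^ k m⊥p))

    -- `n / d` becomes `n` times the p-adic inverse of `d`, and its own inverse is `d` times that of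
    -- `n`.
    coprime-ratio-∈ℤˣ : ∀ {q n d} → ↥ q ≡ + n → ↧ q ≡ + d → Coprime n p → Coprime d p → q ∈ℤˣ[ p ]
    coprime-ratio-∈ℤˣ {q} {n} {d} ↥≡n ↧≡d n⊥p d⊥p = x , (y , xy≈1) , x≈q
      where
      x y : ℤₚ p
      x = fromℤ (+ n) · inverse d⊥p
      y = fromℤ (+ d) · inverse n⊥p
      xy≈1 : x · y ≈ fromℤ 1ℤ
      xy≈1 k = subst (_ ∣_) (identity (+ n) (approx (inverse d⊥p) k) (+ d) (approx (inverse n⊥p) k))
        (∣m∣n⇒∣m+n (∣n⇒∣m*n (+ n * approx (inverse n⊥p) k) (m*inverse≈1 d⊥p k)) (m*inverse≈1 n⊥p k))
        where
        identity : ∀ n e d f → n * f * (d * e - 1ℤ) + (n * f - 1ℤ) ≡ n * e * (d * f) - 1ℤ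
        identity = solve-∀
      x≈q : x ≈ℚ q
      x≈q = subst₂ (λ num den → x · fromℤ den ≈ fromℤ num) (sym ↥≡n) (sym ↧≡d) λ k →
        subst (_ ∣_) (identity (+ n) (approx (inverse d⊥p) k) (+ d)) (∣n⇒∣m*n (+ n) (m*inverse≈1 d⊥p k))
        where
        identity : ∀ n e d → n * (d * e - 1ℤ) ≡ n * e * d - n
        identity = solve-∀

    ≈⇒reduction : (x y : ℤₚ p) → x ≈ y → + p ∣ reduction x - reduction y
    ≈⇒reduction x y x≈y = subst (λ n → + n ∣ reduction x - reduction y) (ℕ.*-identityʳ p) (x≈y 1)

  module _ {p : ℕ} (pr : Prime p) where

    -- From `num b = den a`, a prime `p` dividing one of `num` and `den` would divide the other as
    -- well, against lowest terms.
    ratio-∈ℤˣ : ∀ {u v} g {a b} .{{_ : NonZero v}} → u ≡ g ℕ.* a → v ≡ g ℕ.* b →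
                p ℕ.∤ a → p ℕ.∤ b → + u ℚ./ v ∈ℤˣ[ p ]
    ratio-∈ℤˣ {u} {v} g {a} {b} u≡ga v≡gb p∤a p∤b =
      coprime-ratio-∈ℤˣ {q = + u ℚ./ v} ↥≡ ↧≡ (∤⇒coprime p∤num) (∤⇒coprime p∤den)
      where
      open LowestTerms (lowestTerms u v)
      ∤⇒coprime : ∀ {n} → p ℕ.∤ n → Coprime n p
      ∤⇒coprime p∤n = Coprimality.sym (prime∧∤⇒coprime pr p∤n)
      num*b≡den*a = common-factor g {a} u≡ga v≡gb
      p∤both : ¬ (p ℕ.∣ num × p ℕ.∣ den)
      p∤both p∣both = ¬prime[1] (subst Prime (coprime p∣both) pr)
      p∤num : p ℕ.∤ num
      p∤num p∣num = ∤-* pr (λ p∣den → p∤both (p∣num , p∣den)) p∤a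
        (subst (p ℕ.∣_) num*b≡den*a (ℕ.∣m⇒∣m*n b p∣num))
      p∤den : p ℕ.∤ den
      p∤den p∣den = ∤-* pr (λ p∣num → p∤both (p∣num , p∣den)) p∤b
        (subst (p ℕ.∣_) (sym num*b≡den*a) (ℕ.∣m⇒∣m*n a p∣den))

    unit⇒p∤reduction : (x : ℤₚ p) → IsUnit x → ¬ + p ∣ reduction x
    unit⇒p∤reduction x (y , xy≈1) p∣x = ¬prime[1] (subst Prime (ℕ.∣1⇒≡1 (∣⇒∣ᵤ (
      subst (_ ∣_) (identity (reduction x * reduction y))
        (∣m∣n⇒∣m-n (∣m⇒∣m*n (reduction y) p∣x) (≈⇒reduction (x · y) (fromℤ 1ℤ) xy≈1))))) pr)
      where
      identity : ∀ n → n - (n - 1ℤ) ≡ 1ℤ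
      identity = solve-∀

    module _ {u v : ℕ} .{{_ : NonZero v}} (r : + u ℚ./ v ∈ℤˣ[ p ]) where

      private x = reduction (proj₁ r)

      open LowestTerms (lowestTerms u v)

      x*den≡num : + p ∣ x * + den - + num
      x*den≡num = ≈⇒reduction (proj₁ r · fromℤ (+ den)) (fromℤ (+ num)) (subst₂ (λ n d → proj₁ r · fromℤ d ≈ fromℤ n) ↥≡ ↧≡ (proj₂ (proj₂ r)))

      -- Since `x den ≡ num` modulo `p`, divisibility of `den` would pass to `num`, against lowest
      -- terms.
      p∤den : p ℕ.∤ den
      p∤den p∣den = ¬prime[1] (subst Prime (coprime (∣⇒∣ᵤ p∣num , p∣den)) pr)
        where
        p∣num : + p ∣ + num
        p∣num = subst (_ ∣_) (identity x (+ den) (+ num))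
          (∣m∣n⇒∣m-n (∣n⇒∣m*n x (∣ᵤ⇒∣ {+ p} {+ den} p∣den)) x*den≡num)
          where
          identity : ∀ x d n → x * d - (x * d - n) ≡ n
          identity = solve-∀

      -- The residue of the ratio is governed by `a` and `b` even if `p` divides the common factor
      -- `g`: the congruence holds for the reduced fraction, and `den` can be cancelled.
      reduction-* : ∀ g {a b} → u ≡ g ℕ.* a → v ≡ g ℕ.* b → + p ∣ x * + b - + a
      reduction-* g {a} {b} u≡ga v≡gb = ∣*⇒∣ _ (prime∧∤⇒coprime pr p∤den)
        (subst (_ ∣_) equation (∣n⇒∣m*n (+ b) x*den≡num))
        where
        open ≡-Reasoning
        identity : ∀ b x d n → b * (x * d - n) ≡ d * (x * b) - n * b
        identity = solve-∀
        identity′ : ∀ b x d a → d * (x * b) - d * a ≡ d * (x * b - a)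
        identity′ = solve-∀
        equation : + b * (x * + den - + num) ≡ + den * (x * + b - + a)
        equation = begin
          + b * (x * + den - + num)               ≡⟨ identity (+ b) x (+ den) (+ num) ⟩
          + den * (x * + b) - + num * + b         ≡⟨ cong (λ n → + den * (x * + b) - n) (begin
            + num * + b     ≡⟨ pos-* num b ⟨
            + (num ℕ.* b)   ≡⟨ cong +_ (common-factor g {a} u≡ga v≡gb) ⟩
            + (den ℕ.* a)   ≡⟨ pos-* den a ⟩
            + den * + a     ∎) ⟩
          + den * (x * + b) - + den * + a         ≡⟨ identity′ (+ b) x (+ den) (+ a) ⟩
          + den * (x * + b - + a)                 ∎

      x*v≡u : + p ∣ x * + v - + u
      x*v≡u = reduction-* 1 (sym (ℕ.*-identityˡ u)) (sym (ℕ.*-identityˡ v))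

      -- A p-adic unit is nonzero modulo `p`, so in `x v ≡ u` either both of `u` and `v` vanish or
      -- neither does. This excludes pairs of denominators of which `p` divides exactly one.
      ∈ℤˣ⇒p∣num⇔p∣den : (p ℕ.∣ u → p ℕ.∣ v) × (p ℕ.∣ v → p ℕ.∣ u)
      ∈ℤˣ⇒p∣num⇔p∣den = to , from
        where
        identity : ∀ n m → n - (n - m) ≡ m
        identity = solve-∀
        identity′ : ∀ n m → (n - m) + m ≡ n
        identity′ = solve-∀
        to : p ℕ.∣ u → p ℕ.∣ v
        to p∣u with p ℕ.∣? v
        ... | yes p∣v = p∣v
        ... | no  p∤v = contradiction (∣*⇒∣ x (prime∧∤⇒coprime pr p∤v)
          (subst (_ ∣_) (trans (identity′ (x * + v) (+ u)) (*-comm x (+ v))) (∣m∣n⇒∣m+n x*v≡u (∣ᵤ⇒∣ {+ p} {+ u} p∣u))))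
          (unit⇒p∤reduction (proj₁ r) (proj₁ (proj₂ r)))
        from : p ℕ.∣ v → p ℕ.∣ u
        from p∣v = ∣⇒∣ᵤ (subst (_ ∣_) (identity (x * + v) (+ u))
          (∣m∣n⇒∣m-n (∣n⇒∣m*n x (∣ᵤ⇒∣ {+ p} {+ v} p∣v)) x*v≡u))

    legendre≡-1 : ∀ {a} → ¬ + p ∣ a → ¬ IsSquareMod p a → legendre p a ≡ -1ℤ
    legendre≡-1 {a} p∤a nonsquare with + p ∣? a | isSquareMod? p a
    ... | yes p∣a | _          = contradiction p∣a p∤a
    ... | no _    | yes square = contradiction square nonsquare
    ... | no _    | no _       = refl

    -- If `w² ≡ −x`, multiplying by `b` and using `x b ≡ a` gives `w² b + a ≡ 0`, which
    -- `nonsquare-a/b` forbids.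
    NonsquareRatio⇒legendre≡-1 : ∀ {u v w} .{{_ : NonZero v}} → NonsquareRatio p u v w →
      (r : + u ℚ./ v ∈ℤˣ[ p ]) → legendreℤₚ (⊖ proj₁ r) ≡ -1ℤ
    NonsquareRatio⇒legendre≡-1 {u} {v} ratio r = legendre≡-1
      (λ p∣-x → unit⇒p∤reduction (proj₁ r) (proj₁ (proj₂ r)) (subst (_ ∣_) (neg-involutive x) (∣m⇒∣-m p∣-x)))
      (λ (w , p∣w²+x) → nonsquare-a/b (toℕ w) (∣⇒∣ᵤ (subst (_ ∣_) (equation (toℕ w))
        (∣m∣n⇒∣m-n (∣n⇒∣m*n (+ b) p∣w²+x) (reduction-* r g α≡ β≡)))))
      where
      open NonsquareRatio ratio
      open ≡-Reasoning
      x = reduction (proj₁ r)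
      identity : ∀ b w x a → b * (w * w - - x) - (x * b - a) ≡ w * w * b + a
      identity = solve-∀
      equation : ∀ w → + b * (+ w * + w - - x) - (x * + b - + a) ≡ + (w ℕ.* w ℕ.* b ℕ.+ a)
      equation w = begin
        + b * (+ w * + w - - x) - (x * + b - + a)   ≡⟨ identity (+ b) (+ w) x (+ a) ⟩
        + w * + w * + b + + a                       ≡⟨ cong (λ n → n * + b + + a) (pos-* w w) ⟨
        + (w ℕ.* w) * + b + + a                     ≡⟨ cong (_+ + a) (pos-* (w ℕ.* w) b) ⟨
        + (w ℕ.* w ℕ.* b ℕ.+ a)                     ∎

    module _ (u : Fin 3 → ℕ) .{{_ : ∀ {i} → NonZero (u i)}} where

      Conclusion : Set
      Conclusion = (∃₂ λ i j → i ≢ j × (+ u i ℚ./ u j) ∈ℤˣ[ p ]) ×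
                   (∀ i j → i ≢ j → (r : (+ u i ℚ./ u j) ∈ℤˣ[ p ]) → legendreℤₚ (⊖ proj₁ r) ≡ -1ℤ)

      -- By `separated`, every pair that involves `k` fails the divisibility criterion; what remains
      -- is the pair `i`, `j` in either order.
      ratio⇒conclusion : ∀ {i j k} → i ≢ j → (∀ l → l ≡ i ⊎ l ≡ j ⊎ l ≡ k) →
                         NonsquareRatio p (u i) (u j) (u k) → Conclusion
      ratio⇒conclusion {i} {j} {k} i≢j cover ratio = (i , j , i≢j , ratio-∈ℤˣ g α≡ β≡ p∤a p∤b) , symbol
        where
        open NonsquareRatio ratio
        i/k : ¬ ((p ℕ.∣ u i → p ℕ.∣ u k) × (p ℕ.∣ u k → p ℕ.∣ u i))
        i/k (f , g) with separated
        ... | inj₁ (p∤i , _ , p∣k) = p∤i (g p∣k)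
        ... | inj₂ (p∣i , _ , p∤k) = p∤k (f p∣i)
        j/k : ¬ ((p ℕ.∣ u j → p ℕ.∣ u k) × (p ℕ.∣ u k → p ℕ.∣ u j))
        j/k (f , g) with separated
        ... | inj₁ (_ , p∤j , p∣k) = p∤j (g p∣k)
        ... | inj₂ (_ , p∣j , p∤k) = p∤k (f p∣j)
        symbol : ∀ l m → l ≢ m → (r : (+ u l ℚ./ u m) ∈ℤˣ[ p ]) → legendreℤₚ (⊖ proj₁ r) ≡ -1ℤ
        symbol l m l≢m r with cover l | cover m
        ... | inj₁ refl        | inj₁ refl        = contradiction refl l≢m
        ... | inj₁ refl        | inj₂ (inj₁ refl) = NonsquareRatio⇒legendre≡-1 ratio r
        ... | inj₁ refl        | inj₂ (inj₂ refl) = contradiction (∈ℤˣ⇒p∣num⇔p∣den r) i/k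
        ... | inj₂ (inj₁ refl) | inj₁ refl        = NonsquareRatio⇒legendre≡-1 (NonsquareRatio-sym ratio) r
        ... | inj₂ (inj₁ refl) | inj₂ (inj₁ refl) = contradiction refl l≢m
        ... | inj₂ (inj₁ refl) | inj₂ (inj₂ refl) = contradiction (∈ℤˣ⇒p∣num⇔p∣den r) j/k
        ... | inj₂ (inj₂ refl) | inj₁ refl        = contradiction (swap (∈ℤˣ⇒p∣num⇔p∣den r)) i/k
        ... | inj₂ (inj₂ refl) | inj₂ (inj₁ refl) = contradiction (swap (∈ℤˣ⇒p∣num⇔p∣den r)) j/k
        ... | inj₂ (inj₂ refl) | inj₂ (inj₂ refl) = contradiction refl l≢m

-- The rational equation, with one case for each pair of indices.

open PAdicRatios using (equation⇒Solution; ratio⇒conclusion)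
open EgyptianFractions using (some-ratio)
open import Data.Sum using (inj₁; inj₂)
open import Data.Nat using (ℕ; NonZero)
open import Data.Nat.Divisibility using (_∤_)
open import Data.Nat.Primality using (Prime)
open import Data.Integer using (+_; -1ℤ)
open import Data.Rational using (_/_; _+_)
open import Data.Fin using (Fin)
open import Data.Fin.Patterns using (0F; 1F; 2F)
open import Data.Product using (∃₂; _×_; proj₁)
open import Relation.Binary.PropositionalEquality using (_≡_; _≢_; refl)

corollary1p3 : (p : ℕ) .{{_ : NonZero p}} → Prime p → 2 ∤ p →
    (u : Fin 3 → ℕ) .{{_ : ∀ {i} → NonZero (u i)}} →
    + 4 / p ≡ + 1 / u 0F + + 1 / u 1F + + 1 / u 2F →
    (∃₂ λ i j → i ≢ j × (+ u i / u j) ∈ℤˣ[ p ]) ×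
    (∀ i j → i ≢ j → (r : (+ u i / u j) ∈ℤˣ[ p ]) →
      legendreℤₚ (⊖ proj₁ r) ≡ -1ℤ)
corollary1p3 p pr 2∤p u eq
  with some-ratio pr 2∤p (u 0F) (u 1F) (u 2F) (equation⇒Solution p (u 0F) (u 1F) (u 2F) eq)
... | inj₁ r        =
  ratio⇒conclusion pr u (λ ()) (λ { 0F → inj₁ refl ; 1F → inj₂ (inj₁ refl) ; 2F → inj₂ (inj₂ refl) }) r
... | inj₂ (inj₁ r) =
  ratio⇒conclusion pr u (λ ()) (λ { 0F → inj₁ refl ; 2F → inj₂ (inj₁ refl) ; 1F → inj₂ (inj₂ refl) }) r
... | inj₂ (inj₂ r) =
  ratio⇒conclusion pr u (λ ()) (λ { 1F → inj₁ refl ; 2F → inj₂ (inj₁ refl) ; 0F → inj₂ (inj₂ refl) }) r
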